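{- Assuming Gap-ETH, there exist constants $\delta,r_0>0$ such that for any positive integers $q\ge r\ge r_0$, no algorithm can take a graph $G$ and distinguish between $\mathrm{Clique}(G)\ge q$ and $\mathrm{Clique}(G)<r$ in $O_{q,r}(|V(G)|^{\delta r})$ time. Consequently (assuming Gap-ETH) Maximum Clique and Maximum Independent Set are inherently enumerative, hence totally FPT inapproximable.
   Context: Gap-ETH: there exist constants $\delta,\epsilon>0$ such that no (randomized) algorithm can, given a 3-SAT formula on $n$ variables and $m=O(n)$ clauses, correctly distinguish with probability at least $2/3$ in time $O(2^{\delta n})$ between the case that all $m$ clauses are simultaneously satisfiable and the case that every assignment satisfies fewer than $(1-\epsilon)m$ clauses. $\mathrm{Clique}(G)$ is the maximum size of a clique in $G$. $O_{q,r}(\cdot)$ hides a multiplicative factor depending only on $q,r$. A problem with optimum value $\mathrm{OPT}(I)$ is inherently enumerative if there exist constants $\delta,r_0>0$ such that for all integers $q\ge r\ge r_0$ no algorithm can, on every instance $I$, decide whether $\mathrm{OPT}(I)<r$ or $\mathrm{OPT}(I)\ge q$ in time $O_{q,r}(|I|^{\delta r})$. A maximization problem is totally FPT inapproximable if for no computable $f:\mathbb{N}\to[1,\infty)$ with $k/f(k)\to\infty$ is there an algorithm that, given $(I,k)$, runs in time $t(k)|I|^{O(1)}$ for some computable $t$ and outputs 1 when $\mathrm{OPT}(I)\ge k$ and 0 when $\mathrm{OPT}(I)<k/f(k)$. -}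

module Defs where

open import Data.Bool using (Bool; true; false)
import Data.Bool.Properties as Bool
open import Data.Fin using (Fin; toℕ)
import Data.Fin.Properties as Fin
open import Data.Fin.Subset using (Subset; inside; outside; _∈_; ∣_∣; ⊥)
open import Data.Fin.Subset.Properties using (_∈?_; ∉⊥)
open import Data.Integer as ℤ using (ℤ; +_; -[1+_])
open import Data.List as List using (List; []; _∷_; _++_; length; filter; tabulate)
open import Data.List.Extrema.Nat using (argmax; argmax-all; v≤f[argmax]⁺)
open import Data.List.Membership.Propositional as List∈ using ()
open import Data.List.Membership.Propositional.Properties
  using (∈-++⁺ˡ; ∈-++⁺ʳ; ∈-map⁺; ∈-filter⁺)
open import Data.List.Relation.Unary.All as All using (All)
open import Data.List.Relation.Unary.All.Properties using (all-filter)
open import Data.List.Relation.Unary.Any as ListAny using (here)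
open import Data.List.Relation.Unary.Unique.Propositional using (Unique)
open import Data.Nat using (ℕ; zero; suc; _+_; _*_; _^_; _≤_; _<_; _≥_; _⊔_)
open import Data.Nat.Properties using (≤-reflexive)
open import Data.Product using (Σ-syntax; ∃-syntax; _×_; _,_)
open import Data.Rational as ℚ using (ℚ; 0ℚ; 1ℚ; ↥_; ↧ₙ_)
open import Data.Sum using (inj₂)
open import Data.Vec using (Vec; []; _∷_; toList)
open import Data.Vec.Relation.Unary.Any using (Any; any?)
open import Function using (_∘_)
open import Relation.Binary.PropositionalEquality using (_≡_; _≢_; refl; cong)
open import Relation.Nullary using (¬_; contradiction)
open import Relation.Nullary.Decidable using (_→-dec_; ¬?)
open import Relation.Unary using (Decidable)

------------------------------------------------------------------------
-- Model of computation: a structured language on binary trees in the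
-- style of Jones' WHILE.  Trees are shared immutable heap cells, so each
-- primitive operation costs one unit, and running times agree with those
-- of (multi-tape) Turing machines up to a polynomial.

data Tree : Set where
  nil  : Tree
  cons : Tree → Tree → Tree

size : Tree → ℕ
size nil        = 1
size (cons x y) = suc (size x + size y)

head tail : Tree → Tree
head nil        = nil
head (cons x _) = x
tail nil        = nil
tail (cons _ y) = y

bit : Bool → Tree
bit false = nil
bit true  = cons nil nil

infixr 5 _⨾_

-- A program maps the current tree to a new one; `_⨾_` is composition in
-- diagrammatic order and `flip` returns a fresh fair random bit.
data Program : Set where
  id nil hd tl flip : Program
  cons              : Program → Program → Program
  _⨾_               : Program → Program → Program
  if_then_else_     : Program → Program → Program → Program
  while_loop_         : Program → Program → Program

-- Eval p x ω y ω′ t : on input x and with the coin outcomes ω still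
-- unused, p halts with output y after t steps, leaving ω′ unused.
data Eval : Program → Tree → List Bool → Tree → List Bool → ℕ → Set where
  id   : ∀ {x ω} → Eval id x ω x ω 1
  nil  : ∀ {x ω} → Eval nil x ω nil ω 1
  hd   : ∀ {x ω} → Eval hd x ω (head x) ω 1
  tl   : ∀ {x ω} → Eval tl x ω (tail x) ω 1
  flip : ∀ {x b ω} → Eval flip x (b ∷ ω) (bit b) ω 1
  cons : ∀ {p q x y z ω ω₁ ω₂ s t} →
         Eval p x ω y ω₁ s → Eval q x ω₁ z ω₂ t →
         Eval (cons p q) x ω (cons y z) ω₂ (suc (s + t))
  _⨾_  : ∀ {p q x y z ω ω₁ ω₂ s t} →
         Eval p x ω y ω₁ s → Eval q y ω₁ z ω₂ t →
         Eval (p ⨾ q) x ω z ω₂ (suc (s + t))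
  if-true : ∀ {c p q x u v y ω ω₁ ω₂ s t} →
         Eval c x ω (cons u v) ω₁ s → Eval p x ω₁ y ω₂ t →
         Eval (if c then p else q) x ω y ω₂ (suc (s + t))
  if-false : ∀ {c p q x y ω ω₁ ω₂ s t} →
         Eval c x ω nil ω₁ s → Eval q x ω₁ y ω₂ t →
         Eval (if c then p else q) x ω y ω₂ (suc (s + t))
  while-true : ∀ {c p x u v y z ω ω₁ ω₂ ω₃ r s t} →
         Eval c x ω (cons u v) ω₁ r → Eval p x ω₁ y ω₂ s →
         Eval (while c loop p) y ω₂ z ω₃ t →
         Eval (while c loop p) x ω z ω₃ (suc (r + s + t))
  while-false : ∀ {c p x ω ω₁ s} →
         Eval c x ω nil ω₁ s →
         Eval (while c loop p) x ω x ω₁ (suc s)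

-- A run on the empty coin sequence cannot evaluate `flip`.  Hence the
-- deterministic algorithms are the programs all of whose runs are of
-- this form.
DetEval : Program → Tree → Tree → ℕ → Set
DetEval p x y t = Eval p x [] y [] t

output0 output1 : Tree
output0 = bit false
output1 = bit true

------------------------------------------------------------------------
-- Encodings

list : List Tree → Tree
list = List.foldr cons nil

unary : ℕ → Tree
unary zero    = nil
unary (suc n) = cons nil (unary n)

integer : ℤ → Tree
integer (+ n)    = cons (bit false) (unary n)
integer -[1+ n ] = cons (bit true) (unary n)

rational : ℚ → Tree
rational q = cons (integer (↥ q)) (unary (↧ₙ q))

Computable : {A B : Set} → (A → Tree) → (B → Tree) → (A → B) → Set
Computable encA encB f =
  Σ[ p ∈ Program ] ∀ a → ∃[ t ] DetEval p (encA a) (encB (f a)) t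

pair : ℕ × ℕ → Tree
pair (m , n) = cons (unary m) (unary n)

------------------------------------------------------------------------
-- t ≤[ C * x ^[ δ * n ]] says t ≤ C · x^(δ n) over the reals, for a
-- positive rational δ, after raising to the denominator of δ.

_≤[_*_^[_*_]] : ℕ → ℕ → ℕ → ℚ → ℕ → Set
t ≤[ C * x ^[ δ * n ]] =
  t ^ ↧ₙ δ ≤ C ^ ↧ₙ δ * x ^ (ℤ.∣ ↥ δ ∣ * n)

------------------------------------------------------------------------
-- 3-SAT

record Literal (n : ℕ) : Set where
  constructor literal
  field
    variable-index : Fin n
    polarity       : Bool

-- Literals may be repeated, so shorter nonempty clauses are covered.
Clause : ℕ → Set
Clause n = Vec (Literal n) 3

Formula : ℕ → Set
Formula n = List (Clause n)

Assignment : ℕ → Set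
Assignment n = Fin n → Bool

module _ {n : ℕ} where
  open Literal

  SatisfiesLiteral : Assignment n → Literal n → Set
  SatisfiesLiteral a l = a (variable-index l) ≡ polarity l

  Satisfies : Assignment n → Clause n → Set
  Satisfies a = Any (SatisfiesLiteral a)

  satisfies? : ∀ a → Decidable (Satisfies a)
  satisfies? a = any? λ l → a (variable-index l) Bool.≟ polarity l

  satisfied : Assignment n → Formula n → ℕ
  satisfied a φ = length (filter (satisfies? a) φ)

  Satisfiable : Formula n → Set
  Satisfiable φ = Σ[ a ∈ Assignment n ] All (Satisfies a) φ

  SatisfiesFewerThan[1-_] : ℚ → Formula n → Set
  SatisfiesFewerThan[1- ε ] φ = ∀ a →
    (+ satisfied a φ) ℚ./ 1 ℚ.< (1ℚ ℚ.- ε) ℚ.* ((+ length φ) ℚ./ 1)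

  encodeLiteral : Literal n → Tree
  encodeLiteral l = cons (bit (polarity l)) (unary (toℕ (variable-index l)))

  encodeFormula : Formula n → Tree
  encodeFormula φ =
    cons (unary n) (list (List.map (list ∘ List.map encodeLiteral ∘ toList) φ))

------------------------------------------------------------------------
-- Gap-ETH

-- A uniformly random ω ∈ {0,1}^T satisfies P with probability ≥ 2/3.
Probability≥2/3 : (T : ℕ) → (Vec Bool T → Set) → Set
Probability≥2/3 T P =
  Σ[ good ∈ List (Vec Bool T) ]
    Unique good × All P good × 2 * 2 ^ T ≤ 3 * length good

-- p halts on x within T steps whatever the coins show.  Each flip costs a
-- step, so T coins are enough.
HaltsWithin : ℕ → Program → Tree → Set
HaltsWithin T p x = ∀ (ω : Vec Bool T) →
  ∃[ y ] ∃[ ω′ ] ∃[ t ] Eval p x (toList ω) y ω′ t × t ≤ T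

Outputs : Program → Tree → Tree → ∀ {T} → Vec Bool T → Set
Outputs p x y ω = ∃[ ω′ ] ∃[ t ] Eval p x (toList ω) y ω′ t

-- A randomized algorithm for the gap problem on formulas with at most c n
-- clauses that runs in time O(2^(δ n)).
Gap3SATAlgorithm : (δ ε : ℚ) (c : ℕ) → Set
Gap3SATAlgorithm δ ε c =
  Σ[ p ∈ Program ] Σ[ C ∈ ℕ ]
    ∀ n (φ : Formula n) → length φ ≤ c * n →
      Σ[ T ∈ ℕ ]
          T ≤[ C * 2 ^[ δ * n ]]
        × HaltsWithin T p (encodeFormula φ)
        × (Satisfiable φ →
             Probability≥2/3 T (Outputs p (encodeFormula φ) output1))
        × (SatisfiesFewerThan[1- ε ] φ →
             Probability≥2/3 T (Outputs p (encodeFormula φ) output0))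

-- The constant hidden in m = O(n) is chosen together with δ and ε.
GapETH : Set
GapETH =
  Σ[ δ ∈ ℚ ] Σ[ ε ∈ ℚ ] Σ[ c ∈ ℕ ]
    0ℚ ℚ.< δ × 0ℚ ℚ.< ε × ¬ Gap3SATAlgorithm δ ε c

------------------------------------------------------------------------
-- Graphs, cliques and independent sets

record Graph : Set where
  field
    order       : ℕ
    adjacent    : Fin order → Fin order → Bool
    symmetric   : ∀ u v → adjacent u v ≡ adjacent v u
    irreflexive : ∀ u → adjacent u u ≡ false

open Graph public

encodeGraph : Graph → Tree
encodeGraph G =
  list (tabulate λ u → list (tabulate λ v → bit (adjacent G u v)))

IsClique : (G : Graph) → Subset (order G) → Set
IsClique G S = ∀ u → u ∈ S → ∀ v → v ∈ S → u ≢ v → adjacent G u v ≡ true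

IsIndependent : (G : Graph) → Subset (order G) → Set
IsIndependent G S = ∀ u → u ∈ S → ∀ v → v ∈ S → adjacent G u v ≡ false

isClique? : ∀ G → Decidable (IsClique G)
isClique? G S = Fin.all? λ u → (u ∈? S) →-dec Fin.all? λ v → (v ∈? S) →-dec
  (¬? (u Fin.≟ v) →-dec (adjacent G u v Bool.≟ true))

isIndependent? : ∀ G → Decidable (IsIndependent G)
isIndependent? G S = Fin.all? λ u → (u ∈? S) →-dec Fin.all? λ v → (v ∈? S) →-dec
  (adjacent G u v Bool.≟ false)

subsets : ∀ n → List (Subset n)
subsets zero    = [] ∷ []
subsets (suc n) =
  List.map (inside ∷_) (subsets n) ++ List.map (outside ∷_) (subsets n)

∈-subsets : ∀ {n} (S : Subset n) → S List∈.∈ subsets n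
∈-subsets []            = here refl
∈-subsets (inside  ∷ S) = ∈-++⁺ˡ (∈-map⁺ (inside ∷_) (∈-subsets S))
∈-subsets (outside ∷ S) =
  ∈-++⁺ʳ (List.map (inside ∷_) (subsets _)) (∈-map⁺ (outside ∷_) (∈-subsets S))

-- The starting value ⊥ is itself a clique and an independent set.
largest : ∀ {n} {P : Subset n → Set} → Decidable P → Subset n
largest {n} P? = argmax ∣_∣ ⊥ (filter P? (subsets n))

largest-satisfies : ∀ {n} {P : Subset n → Set} (P? : Decidable P) →
                    P ⊥ → P (largest P?)
largest-satisfies {n} {P} P? P⊥ =
  argmax-all ∣_∣ {P = P} P⊥ (all-filter P? (subsets n))

largest-maximum : ∀ {n} {P : Subset n → Set} (P? : Decidable P) →
                  ∀ S → P S → ∣ S ∣ ≤ ∣ largest P? ∣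
largest-maximum {n} P? S PS = v≤f[argmax]⁺ ⊥ (filter P? (subsets n))
  (inj₂ (ListAny.map (λ S≡S′ → ≤-reflexive (cong ∣_∣ S≡S′))
                     (∈-filter⁺ P? (∈-subsets S) PS)))

cliqueNumber : Graph → ℕ
cliqueNumber G = ∣ largest (isClique? G) ∣

independenceNumber : Graph → ℕ
independenceNumber G = ∣ largest (isIndependent? G) ∣

------------------------------------------------------------------------
-- Maximization problems

record MaximizationProblem : Set₁ where
  field
    Instance : Set
    encode   : Instance → Tree
    Solution : Instance → Set
    value    : ∀ I → Solution I → ℕ
    OPT      : Instance → ℕ
    attained : ∀ I → Σ[ s ∈ Solution I ] value I s ≡ OPT I
    maximum  : ∀ I s → value I s ≤ OPT I

  ∥_∥ : Instance → ℕ
  ∥ I ∥ = size (encode I)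

MaximumClique : MaximizationProblem
MaximumClique = record
  { Instance = Graph
  ; encode   = encodeGraph
  ; Solution = λ G → Σ[ S ∈ Subset (order G) ] IsClique G S
  ; value    = λ { _ (S , _) → ∣ S ∣ }
  ; OPT      = cliqueNumber
  ; attained = λ G → (largest (isClique? G) ,
      largest-satisfies (isClique? G) (λ _ u∈⊥ → contradiction u∈⊥ ∉⊥)) , refl
  ; maximum  = λ { G (S , cl) → largest-maximum (isClique? G) S cl }
  }

MaximumIndependentSet : MaximizationProblem
MaximumIndependentSet = record
  { Instance = Graph
  ; encode   = encodeGraph
  ; Solution = λ G → Σ[ S ∈ Subset (order G) ] IsIndependent G S
  ; value    = λ { _ (S , _) → ∣ S ∣ }
  ; OPT      = independenceNumber
  ; attained = λ G → (largest (isIndependent? G) ,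
      largest-satisfies (isIndependent? G) (λ _ u∈⊥ → contradiction u∈⊥ ∉⊥)) , refl
  ; maximum  = λ { G (S , ind) → largest-maximum (isIndependent? G) S ind }
  }

-- A deterministic algorithm that tells opt ≥ q (output 1) from opt < r
-- (output 0) in time O(measure^(δ r)).  The measure is replaced by 1 where
-- it is 0: a time bound of 0 on the empty graph would rule out every
-- algorithm.
GapAlgorithm : {I : Set} → (I → Tree) → (measure opt : I → ℕ) →
               (δ : ℚ) (q r : ℕ) → Set
GapAlgorithm encode measure opt δ q r =
  Σ[ p ∈ Program ] Σ[ C ∈ ℕ ]
    ∀ x → ∃[ y ] ∃[ t ]
        DetEval p (encode x) y t
      × t ≤[ C * (1 ⊔ measure x) ^[ δ * r ]]
      × (opt x ≥ q → y ≡ output1)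
      × (opt x < r → y ≡ output0)

CliqueGapAlgorithm : (δ : ℚ) (q r : ℕ) → Set
CliqueGapAlgorithm = GapAlgorithm encodeGraph order cliqueNumber

InherentlyEnumerative : MaximizationProblem → Set
InherentlyEnumerative Π =
  Σ[ δ ∈ ℚ ] Σ[ r₀ ∈ ℕ ]
    0ℚ ℚ.< δ × 0 < r₀ ×
    (∀ q r → q ≥ r → r ≥ r₀ → ¬ GapAlgorithm encode ∥_∥ OPT δ q r)
  where open MaximizationProblem Π

------------------------------------------------------------------------
-- Computable functions ℕ → [1,∞).  A real is given by a regular sequence
-- of rationals (Bishop): the j-th term is within 1/(j+1) of its limit.

1/suc : ℕ → ℚ
1/suc j = (+ 1) ℚ./ suc j

record ComputableFunction[1,∞⟩ : Set where
  field
    approx     : ℕ → ℕ → ℚ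
    regular    : ∀ k i j →
                 ℚ.∣ approx k i ℚ.- approx k j ∣ ℚ.≤ 1/suc i ℚ.+ 1/suc j
    ≥1         : ∀ k j → 1ℚ ℚ.- 1/suc j ℚ.≤ approx k j
    computable : Computable pair rational (λ { (k , j) → approx k j })

-- n < k / f(k), in the form n · f(k) < k, which is equivalent as f(k) ≥ 1.
-- The real n · f(k) is below k iff one of the upper bounds
-- n · (approx k j + 1/(j+1)) is.
_<_/[_] : ℕ → (k : ℕ) → ComputableFunction[1,∞⟩ → Set
n < k /[ f ] = ∃[ j ]
  ((+ n) ℚ./ 1) ℚ.* (approx k j ℚ.+ 1/suc j) ℚ.< (+ k) ℚ./ 1
  where open ComputableFunction[1,∞⟩ f

k/_⟶∞ : ComputableFunction[1,∞⟩ → Set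
k/ f ⟶∞ = ∀ M → ∃[ K ] ∀ k → k ≥ K → M < k /[ f ]

module _ (Π : MaximizationProblem) where
  open MaximizationProblem Π

  FPTApproximation : ComputableFunction[1,∞⟩ → Set
  FPTApproximation f =
    Σ[ p ∈ Program ] Σ[ t ∈ (ℕ → ℕ) ] Σ[ c ∈ ℕ ]
      Computable unary unary t ×
      (∀ I k → ∃[ y ] ∃[ s ]
          DetEval p (cons (encode I) (unary k)) y s
        × s ≤ t k * ∥ I ∥ ^ c
        × (OPT I ≥ k → y ≡ output1)
        × (OPT I < k /[ f ] → y ≡ output0))

  TotallyFPTInapproximable : Set
  TotallyFPTInapproximable = ∀ f → k/ f ⟶∞ → ¬ FPTApproximation f

{-# OPTIONS --safe #-}
module Submission where

open import Defs
open import Data.Bool as Bool using (Bool; true; false; not; _∧_; _xor_)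
open import Data.Bool.ListAction using (any)
open import Data.Bool.Properties using (T-≡; T-∧; not-injective)
open import Data.Fin using (Fin; zero; suc; toℕ)
import Data.Fin.Properties as Fin
open import Data.Fin.Subset as Subset using (Subset; inside; outside; ∣_∣; ⁅_⁆; _∪_)
import Data.Fin.Subset.Properties as Subset
open import Data.Integer as ℤ using (+_; -[1+_])
import Data.Integer.Properties as ℤ
import Data.Integer.Solver as ℤ
open import Data.List as List using (List; []; _∷_; _++_; length; _ʳ++_; reverse)
open import Data.List.Membership.Propositional using (_∈_; find; lose)
open import Data.List.Membership.Propositional.Properties
  using (∈-map⁺; ∈-map⁻; ∈-concatMap⁺; ∈-concatMap⁻; ∈-lookup; ∈-allFin)
import Data.List.Properties as List
open import Data.List.Relation.Binary.Disjoint.Propositional using (Disjoint)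
open import Data.List.Relation.Binary.Subset.Propositional using (_⊆_)
open import Data.List.Relation.Unary.All as All using (All; []; _∷_)
import Data.List.Relation.Unary.All.Properties as All
open import Data.List.Relation.Unary.AllPairs using ([]; _∷_)
open import Data.List.Relation.Unary.Any as Any using (here; there)
open import Data.List.Relation.Unary.Any.Properties as Any using (reverseAcc⁺; reverseAcc⁻)
open import Data.List.Relation.Unary.Unique.Propositional using (Unique)
import Data.List.Relation.Unary.Unique.Propositional.Properties as Unique
open import Data.Nat
open import Data.Nat.Coprimality using (1-coprimeTo)
open import Data.Nat.DivMod using (m≡m%n+[m/n]*n; m%n<n; m/n*n≤m; m*n/n≡m; /-monoˡ-≤)
open import Data.Nat.Properties
open import Data.Nat.Solver using (module +-*-Solver)
open import Data.Product using (Σ-syntax; ∃-syntax; _×_; _,_; proj₁; proj₂)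
open import Data.Rational as ℚ using (ℚ; mkℚ; 0ℚ; 1ℚ; ↥_; ↧ₙ_; toℚᵘ)
import Data.Rational.Properties as ℚ
import Data.Rational.Unnormalised as ℚᵘ
import Data.Rational.Unnormalised.Properties as ℚᵘ
open import Data.Sum as Sum using (_⊎_; inj₁; inj₂)
open import Data.Unit using (⊤; tt)
open import Data.Vec as Vec using (Vec; []; _∷_; toList)
open import Data.Vec.Properties using (∷-injectiveʳ)
open import Data.Vec.Relation.Unary.Any.Properties using (toList⁺; toList⁻)
open import Function using (_∘_; case_of_)
open import Function.Bundles using (Equivalence)
open import Relation.Binary.PropositionalEquality
open import Relation.Nullary using (¬_; Dec; contradiction; yes; no)

-- A 3-SAT formula is turned into a q-partite graph.  Its clauses are
-- distributed over q sets S₁, …, S_q, each containing about a fraction 1/B of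
-- them, such that any r of the sets together miss at most a fraction
-- (1 − 1/B)^r ≤ ε.  The vertices of part i choose one literal from every
-- clause of Sᵢ to be true, and vertices of different parts are adjacent when
-- their choices are consistent.  A satisfying assignment yields a clique of
-- size q, while a clique of size r yields an assignment missing at most an
-- ε-fraction of the clauses.  With B proportional to r there are 2^(O(m/r))
-- vertices, so an algorithm running in time |V|^(δ r) decides the gap in time
-- 2^(O(δ m)); the reduction itself takes time 2^(O(m/r)) up to polynomial
-- factors, which is small for large r.  For independent sets the complement of
-- the graph is produced instead.
--
-- The sets come from a deterministic design: the masks record for every word
-- in {1, …, B}^q which coordinates equal 1, and the clauses run cyclically
-- through them.

-- Choosing the sets at random would also work, but a product design attains the expected densities
-- exactly over each full cycle: counting words replaces probability, and the algorithm ignores its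
-- coins. The number of masks depends on q and r only, so they are written into the program, and the
-- q parts are unrolled into separate copies of code. Both affect the constant in the running time
-- and nothing else. Two opposing demands fix B. The reduction is polynomial in |V| = 2^(O(m/B)),
-- with a degree that q and r do not influence, so B must exceed a constant given by Gap-ETH; this
-- is the origin of r₀. The gap algorithm takes time 2^(O(δ m r/B)), so B must be at least a
-- constant fraction of r; yet r parts miss few clauses only if r is a large enough multiple of B.
-- Dividing r by the denominator of ε meets both demands. Fixed-parameter inapproximability comes
-- from freezing the parameter at a large k: the FPT algorithm then is a gap algorithm whose
-- exponent stays put while r may grow.

-- Programs with bounds on their running times

-- Running times are measured by K (1 + W)^e, where W bounds the sizes of the
-- data and K is independent of them.  The exponent e is tracked explicitly, as
-- it must not depend on q and r.
record Runs (W e K : ℕ) (p : Program) (x y : Tree) : Set where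
  constructor runs
  field
    run : ∀ ω → ∃[ t ] Eval p x ω y ω t × t ≤ K * suc W ^ e

open Runs public

caseTree : {A : Set} → Tree → A → A → A
caseTree nil        y z = z
caseTree (cons _ _) y z = y

module _ {W e : ℕ} where

  private
    P : ℕ
    P = suc W ^ e

    1≤P : 1 ≤ P
    1≤P = m^n>0 (suc W) e

  weakenK : ∀ {K K′ p x y} → K ≤ K′ → Runs W e K p x y → Runs W e K′ p x y
  weakenK K≤K′ (runs f) = runs λ ω → let t , ev , t≤ = f ω in
    t , ev , ≤-trans t≤ (*-monoˡ-≤ P K≤K′)

  weaken : ∀ {e′ K p x y} → e ≤ e′ → Runs W e K p x y → Runs W e′ K p x y
  weaken {K = K} e≤e′ (runs f) = runs λ ω → let t , ev , t≤ = f ω in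
    t , ev , ≤-trans t≤ (*-monoʳ-≤ K (^-monoʳ-≤ (suc W) e≤e′))

  result : ∀ {K p x y y′} → y ≡ y′ → Runs W e K p x y → Runs W e K p x y′
  result refl r = r

  private
    add : ∀ {a b} K L → a ≤ K * P → b ≤ L * P → a + b ≤ (K + L) * P
    add K L a≤ b≤ = ≤-trans (+-mono-≤ a≤ b≤) (≤-reflexive (sym (*-distribʳ-+ P K L)))

    bump : ∀ {a} K → a ≤ K * P → suc a ≤ suc K * P
    bump K a≤ = +-mono-≤ 1≤P a≤

  infixr 5 _⨾ʳ_
  _⨾ʳ_ : ∀ {K L p q x y z} → Runs W e K p x y → Runs W e L q y z →
         Runs W e (suc (K + L)) (p ⨾ q) x z
  _⨾ʳ_ {K} {L} (runs f) (runs g) = runs λ ω →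
    let s , ev , s≤ = f ω ; t , ev′ , t≤ = g ω in
    _ , ev ⨾ ev′ , bump (K + L) (add K L s≤ t≤)

  consʳ : ∀ {K L p q x y z} → Runs W e K p x y → Runs W e L q x z →
          Runs W e (suc (K + L)) (cons p q) x (cons y z)
  consʳ {K} {L} (runs f) (runs g) = runs λ ω →
    let s , ev , s≤ = f ω ; t , ev′ , t≤ = g ω in
    _ , cons ev ev′ , bump (K + L) (add K L s≤ t≤)

  -- Runs of both branches are required although only one is taken, so no case distinction on the
  -- outcome `w` is needed at the point of use. The sum `L + L′` serves as a bound for the maximum.
  ifʳ : ∀ {K L L′ c p q x w y z} →
        Runs W e K c x w → Runs W e L p x y → Runs W e L′ q x z →
        Runs W e (suc (K + (L + L′))) (if c then p else q) x (caseTree w y z)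
  ifʳ {K} {L} {L′} {w = nil} (runs f) _ (runs g) = runs λ ω →
    let s , ev , s≤ = f ω ; t , ev′ , t≤ = g ω in
    _ , if-false ev ev′ , bump (K + (L + L′)) (add K (L + L′) s≤
      (≤-trans t≤ (*-monoˡ-≤ P (m≤n+m L′ L))))
  ifʳ {K} {L} {L′} {w = cons _ _} (runs f) (runs g) _ = runs λ ω →
    let s , ev , s≤ = f ω ; t , ev′ , t≤ = g ω in
    _ , if-true ev ev′ , bump (K + (L + L′)) (add K (L + L′) s≤
      (≤-trans t≤ (*-monoˡ-≤ P (m≤m+n L L′))))

  data Iterates (K L : ℕ) (c p : Program) : ℕ → Tree → Tree → Set where
    stop : ∀ {x} → Runs W e K c x nil → Iterates K L c p 0 x x
    next : ∀ {k x u v y z} → Runs W e K c x (cons u v) → Runs W e L p x y →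
           Iterates K L c p k y z → Iterates K L c p (suc k) x z

  private
    unroll : ∀ {K L c p k x z} → Iterates K L c p k x z → ∀ ω →
           ∃[ t ] Eval (while c loop p) x ω z ω t × t ≤ suc k * (suc (K + L) * P)
    unroll {K} {L} (stop (runs f)) ω = let s , ev , s≤ = f ω in
      _ , while-false ev , ≤-trans (bump (K + L)
            (≤-trans s≤ (*-monoˡ-≤ P (m≤m+n K L)))) (≤-reflexive (sym (+-identityʳ _)))
    unroll {K} {L} (next (runs f) (runs g) rest) ω =
      let s , ev , s≤ = f ω ; t , ev′ , t≤ = g ω ; u , ev″ , u≤ = unroll rest ω in
      _ , while-true ev ev′ ev″ , +-mono-≤ (bump (K + L) (add K L s≤ t≤)) u≤

  -- Each loop costs one factor `suc W`: k iterations make k + 1 tests, and k ≤ W. The constant does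
  -- not see the number of iterations, so the exponent counts the nesting depth of loops.
  whileʳ : ∀ {K L c p k x z} → k ≤ W → Iterates K L c p k x z →
           Runs W (suc e) (suc (K + L)) (while c loop p) x z
  whileʳ {K} {L} k≤W it = runs λ ω → let t , ev , t≤ = unroll it ω in
    t , ev , ≤-trans t≤ (≤-trans (*-monoˡ-≤ (suc (K + L) * P) (s≤s k≤W))
      (≤-reflexive (begin
        suc W * (suc (K + L) * P)  ≡⟨ sym (*-assoc (suc W) (suc (K + L)) P) ⟩
        suc W * suc (K + L) * P    ≡⟨ cong (_* P) (*-comm (suc W) (suc (K + L))) ⟩
        suc (K + L) * suc W * P    ≡⟨ *-assoc (suc (K + L)) (suc W) P ⟩
        suc (K + L) * (suc W * P)  ∎)))
    where open ≡-Reasoning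

-- Straight-line programs

-- Programs without branches, loops and coin flips are executed by `apply` and timed by `steps`, so
-- their runs are obtained by reflection: `Bool.T (straight p)` reduces to the unit type, and `pure`
-- finds its implicit argument by itself. For other programs `apply` and `steps` have arbitrary
-- values.
straight : Program → Bool
straight id         = true
straight nil        = true
straight hd         = true
straight tl         = true
straight (cons p q) = straight p ∧ straight q
straight (p ⨾ q)    = straight p ∧ straight q
straight _          = false

apply : Program → Tree → Tree
apply hd         x = head x
apply tl         x = tail x
apply (cons p q) x = cons (apply p x) (apply q x)
apply (p ⨾ q)    x = apply q (apply p x)
apply nil        x = nil
apply _          x = x

steps : Program → ℕ
steps (cons p q) = suc (steps p + steps q)
steps (p ⨾ q)    = suc (steps p + steps q)
steps _          = 1

T-∧ˡ : ∀ a {b} → Bool.T (a ∧ b) → Bool.T a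
T-∧ˡ true _ = tt

T-∧ʳ : ∀ a {b} → Bool.T (a ∧ b) → Bool.T b
T-∧ʳ true t = t

module _ {W e : ℕ} where

  private
    unit : ∀ {p x y} → (∀ ω → Eval p x ω y ω 1) → Runs W e 1 p x y
    unit ev = runs λ ω → 1 , ev ω , ≤-trans (m^n>0 (suc W) e) (≤-reflexive (sym (+-identityʳ _)))

  straightʳ : ∀ p x → Bool.T (straight p) → Runs W e (steps p) p x (apply p x)
  straightʳ id  x _ = unit λ _ → id
  straightʳ nil x _ = unit λ _ → nil
  straightʳ hd  x _ = unit λ _ → hd
  straightʳ tl  x _ = unit λ _ → tl
  straightʳ (cons p q) x s = consʳ (straightʳ p x (T-∧ˡ (straight p) s)) (straightʳ q x (T-∧ʳ (straight p) s))
  straightʳ (p ⨾ q) x s =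
    straightʳ p x (T-∧ˡ (straight p) s) ⨾ʳ straightʳ q (apply p x) (T-∧ʳ (straight p) s)

  pure : ∀ {p x} {s : Bool.T (straight p)} → Runs W e (steps p) p x (apply p x)
  pure {p} {x} {s} = straightʳ p x s

constant : Tree → Program
constant nil        = nil
constant (cons x y) = cons (constant x) (constant y)

constantʳ : ∀ {W e} z {x} → Runs W e (steps (constant z)) (constant z) x z
constantʳ nil        = pure
constantʳ (cons x y) = consʳ (constantʳ x) (constantʳ y)


-- Equality of unary numbers, Boolean connectives

-- Strips one unit from both numbers while both are nonzero; they are equal when nothing remains of
-- either.
equalP : Program
equalP = (while (if hd then tl else nil) loop cons (hd ⨾ tl) (tl ⨾ tl))
       ⨾ (if hd then nil else (if tl then nil else constant output1))

-- The constant is quantified before `W` and the input, which makes it uniform; its value is read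
-- off from the derivation by unification. The same form recurs for every program below.
equalP-runs : Σ[ K ∈ ℕ ] ∀ {W} m n → m ≤ W →
  Runs W 1 K equalP (cons (unary m) (unary n)) (bit (m ≡ᵇ n))
equalP-runs = _ , λ {W} m n m≤W →
    whileʳ (≤-trans (m⊓n≤m m n) m≤W) (strip m n)
    ⨾ʳ result (decide m n) (ifʳ pure pure (ifʳ pure pure (constantʳ output1)))
  where
  strip : ∀ {W} m n → Iterates {W} {0} 4 7 _ _ (m ⊓ n) (cons (unary m) (unary n))
                                 (cons (unary (m ∸ n)) (unary (n ∸ m)))
  strip zero    zero    = stop (ifʳ pure pure pure)
  strip zero    (suc n) = stop (ifʳ pure pure pure)
  strip (suc m) zero    = stop (ifʳ pure pure pure)
  strip (suc m) (suc n) = next (ifʳ pure pure pure) pure (strip m n)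

  decide : ∀ m n → _ ≡ bit (m ≡ᵇ n)
  decide zero    zero    = refl
  decide zero    (suc n) = refl
  decide (suc m) zero    = refl
  decide (suc m) (suc n) = decide m n

caseTree-∧ : ∀ a b → caseTree (bit a) (bit b) nil ≡ bit (a ∧ b)
caseTree-∧ true  _ = refl
caseTree-∧ false _ = refl

caseTree-not-∧ : ∀ a b → caseTree (bit a) nil (bit b) ≡ bit (not a ∧ b)
caseTree-not-∧ true  _ = refl
caseTree-not-∧ false _ = refl

caseTree-not : ∀ a → caseTree (bit a) nil output1 ≡ bit (not a)
caseTree-not true  = refl
caseTree-not false = refl

-- Loops over encoded lists

forEach : Program → Program
forEach s = (while hd loop cons (hd ⨾ tl) (cons (hd ⨾ hd) tl ⨾ s)) ⨾ tl

-- The loop is a left fold. `Inv` sees the elements still to come beside the accumulator, so a bound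
-- on the final result can serve as an invariant.
forEachʳ : ∀ {W e K s} {X A : Set} (encX : X → Tree) (encA : A → Tree)
  (f : A → X → A) (Inv : List X → A → Set) →
  (∀ x xs a → Inv (x ∷ xs) a →
     Runs W e K s (cons (encX x) (encA a)) (encA (f a x)) × Inv xs (f a x)) →
  ∀ xs a → Inv xs a → length xs ≤ W →
  Runs W (suc e) (14 + K) (forEach s)
    (cons (list (List.map encX xs)) (encA a)) (encA (List.foldl f a xs))
forEachʳ {W} {e} {K} {s} encX encA f Inv step xs a inv len =
  weakenK (≤-reflexive (cong (λ z → 13 + z) (+-comm K 1)))
    (whileʳ len (visit xs a inv) ⨾ʳ pure)
  where
  visit : ∀ xs a → Inv xs a →
    Iterates {W} {e} 1 (10 + K) hd (cons (hd ⨾ tl) (cons (hd ⨾ hd) tl ⨾ s)) (length xs)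
      (cons (list (List.map encX xs)) (encA a)) (cons nil (encA (List.foldl f a xs)))
  visit []       a inv = stop pure
  visit (x ∷ xs) a inv with step x xs a inv
  ... | r , inv′ = next pure (consʳ pure (pure ⨾ʳ r)) (visit xs (f a x) inv′)

-- A program has a single tree as its state, so a value from outside the loop is carried along and
-- paired with each element. Results are pushed in front of an accumulator, hence the reversal in
-- `mapOntoʳ`.
mapOnto : Program → Program
mapOnto f = forEach (cons (tl ⨾ hd) (cons (cons (tl ⨾ hd) hd ⨾ f) (tl ⨾ tl)))

foldl-map-ʳ++ : ∀ {X Y : Set} (g : X → Y) xs ys →
  List.foldl (λ ys x → g x ∷ ys) ys xs ≡ List.map g xs ʳ++ ys
foldl-map-ʳ++ g []       ys = refl
foldl-map-ʳ++ g (x ∷ xs) ys = foldl-map-ʳ++ g xs (g x ∷ ys)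

mapOntoCost : ℕ → ℕ
mapOntoCost K = 14 + suc (3 + suc (suc (5 + K) + 3))

mapOntoʳ : ∀ {W e K f} {X Y : Set} (encX : X → Tree) (encY : Y → Tree) (z : Tree) (g : X → Y) xs →
  All (λ x → Runs W e K f (cons z (encX x)) (encY (g x))) xs →
  ∀ ys → length xs ≤ W →
  Runs W (suc e) (mapOntoCost K) (mapOnto f)
    (cons (list (List.map encX xs)) (cons z (list (List.map encY ys))))
    (cons z (list (List.map encY (List.map g xs ʳ++ ys))))
mapOntoʳ {W} {e} {K} {f} encX encY z g xs fs ys len =
  result (cong (cons z ∘ list ∘ List.map encY) (foldl-map-ʳ++ g xs ys))
    (forEachʳ encX (cons z ∘ list ∘ List.map encY) (λ ys x → g x ∷ ys)
      (λ xs _ → All (λ x → Runs W e K f (cons z (encX x)) (encY (g x))) xs)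
      (λ { x xs ys (r ∷ rs) → consʳ pure (consʳ (consʳ pure pure ⨾ʳ r) pure) , rs })
      xs ys fs len)

-- Consistency of partial assignments, given as lists of true literals

open Literal

conflict : ∀ {n} → Literal n → Literal n → Bool
conflict l l′ = (toℕ (variable-index l) ≡ᵇ toℕ (variable-index l′)) ∧ (polarity l xor polarity l′)

conflictP : Program
conflictP =
  if cons (hd ⨾ tl) (tl ⨾ tl) ⨾ equalP
  then (if hd ⨾ hd then (if tl ⨾ hd then nil else constant output1) else (tl ⨾ hd))
  else nil

caseTree-xor : ∀ a b → caseTree (bit a) (caseTree (bit b) nil output1) (bit b) ≡ bit (a xor b)
caseTree-xor true  true  = refl
caseTree-xor true  false = refl
caseTree-xor false _     = refl

conflictP-runs : Σ[ K ∈ ℕ ] ∀ {W n} → n ≤ W → (l l′ : Literal n) →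
  Runs W 1 K conflictP (cons (encodeLiteral l) (encodeLiteral l′)) (bit (conflict l l′))
conflictP-runs = _ , λ {W} {n} n≤W l l′ →
  result (trans (cong (λ t → caseTree (bit (toℕ (variable-index l) ≡ᵇ toℕ (variable-index l′))) t nil) (caseTree-xor (polarity l) (polarity l′)))
           (caseTree-∧ (toℕ (variable-index l) ≡ᵇ toℕ (variable-index l′)) _))
    (ifʳ (pure ⨾ʳ proj₂ equalP-runs _ _ (≤-trans (<⇒≤ (Fin.toℕ<n (variable-index l))) n≤W))
         (ifʳ pure (ifʳ pure pure (constantʳ output1)) pure)
         pure)

compatibleWith : ∀ {n} → Literal n → Bool → Literal n → Bool
compatibleWith l b l′ = not (conflict l′ l) ∧ b

consistentFrom : ∀ {n} → List (Literal n) → Bool → Literal n → Bool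
consistentFrom w b l = List.foldl (compatibleWith l) b w

consistent : ∀ {n} → List (Literal n) → Bool
consistent w = List.foldl (consistentFrom w) true w

literals : ∀ {n} → List (Literal n) → Tree
literals w = list (List.map encodeLiteral w)

compatibleWithP consistentFromP consistentP : Program
compatibleWithP =
  cons (tl ⨾ hd) (if cons hd (tl ⨾ hd) ⨾ conflictP then nil else (tl ⨾ tl))
consistentFromP =
  cons (tl ⨾ hd) (cons (tl ⨾ hd) (cons hd (tl ⨾ tl)) ⨾ forEach compatibleWithP ⨾ tl)
consistentP =
  cons id (cons id (constant output1)) ⨾ forEach consistentFromP ⨾ tl

-- The exponent counts three nested loops: two over the pairs of literals and the one inside
-- `equalP`.
consistentP-runs : Σ[ K ∈ ℕ ] ∀ {W n} → n ≤ W → (w : List (Literal n)) → length w ≤ W →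
  Runs W 3 K consistentP (literals w) (bit (consistent w))
consistentP-runs = _ , λ n≤W w len →
  consʳ pure (consʳ pure (constantʳ output1))
  ⨾ʳ forEachʳ encodeLiteral (cons (literals w) ∘ bit) (consistentFrom w) (λ _ _ → ⊤)
       (λ l _ b _ → (consʳ pure
          (pure
          ⨾ʳ forEachʳ encodeLiteral (cons (encodeLiteral l) ∘ bit) (compatibleWith l) (λ _ _ → ⊤)
               (λ l′ _ b _ → consʳ pure
                 (result (caseTree-not-∧ (conflict l′ l) b)
                   (ifʳ (pure ⨾ʳ proj₂ conflictP-runs n≤W l′ l) pure pure)) , tt)
               w b tt len
          ⨾ʳ pure)) , tt)
       w true tt len
  ⨾ʳ pure

Label : (q n : ℕ) → Set
Label q n = Fin q × List (Literal n)

encodeLabel : ∀ {q n} → Label q n → Tree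
encodeLabel (i , w) = cons (unary (toℕ i)) (literals w)

-- Equal part indices exclude an edge, so no clique has two vertices in one part and the graph has
-- no loops. Pushing one list onto another reverses it, hence `_ʳ++_`; consistency ignores the
-- order.
compatible : ∀ {q n} → Label q n → Label q n → Bool
compatible (i , v) (j , w) = not (toℕ i ≡ᵇ toℕ j) ∧ consistent (v ʳ++ w)

compatibleP : Program
compatibleP =
  if cons (hd ⨾ hd) (tl ⨾ hd) ⨾ equalP then nil
  -- `forEach id` prepends: the pair of an element and the accumulated list is already the extended
  -- list.
  else (cons (hd ⨾ tl) (tl ⨾ tl) ⨾ forEach id ⨾ consistentP)

ʳ++-as-foldl : ∀ {A : Set} (v w : List A) → List.foldl (λ w l → l ∷ w) w v ≡ v ʳ++ w
ʳ++-as-foldl []      w = refl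
ʳ++-as-foldl (x ∷ v) w = ʳ++-as-foldl v (x ∷ w)

compatibleP-runs : Σ[ K ∈ ℕ ] ∀ {W q n} → n ≤ W → q ≤ W → (u v : Label q n) →
  length (proj₂ u) + length (proj₂ v) ≤ W →
  Runs W 3 K compatibleP (cons (encodeLabel u) (encodeLabel v)) (bit (compatible u v))
compatibleP-runs = _ , λ {W} n≤W q≤W (i , v) (j , w) len →
  result (caseTree-not-∧ (toℕ i ≡ᵇ toℕ j) (consistent (v ʳ++ w)))
    (ifʳ (pure ⨾ʳ weaken (s≤s z≤n) (proj₂ equalP-runs _ _ (≤-trans (<⇒≤ (Fin.toℕ<n i)) q≤W)))
         pure
         (pure
          ⨾ʳ weaken (s≤s z≤n) (result (cong literals (ʳ++-as-foldl v w))
               (forEachʳ {e = 0} encodeLiteral literals (λ w l → l ∷ w) (λ _ _ → ⊤)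
                 (λ _ _ _ _ → pure , tt) v w tt (≤-trans (m≤m+n _ _) len)))
          ⨾ʳ proj₂ consistentP-runs n≤W (v ʳ++ w)
               (≤-trans (≤-reflexive (List.length-ʳ++ v)) len)))

-- Adjacency matrices

matrix : {X : Set} → (X → X → Bool) → List X → Tree
matrix adj xs = list (List.map (λ x → list (List.map (λ y → bit (adj x y)) xs)) xs)

matrixP : Program → Program
matrixP adjP = cons id (cons id nil) ⨾ mapOnto rowP ⨾ tl
  where
  rowP : Program
  rowP = cons hd (cons tl nil) ⨾ mapOnto adjP ⨾ tl

-- Both loops push their results in front, so rows and columns are reversed alike and the outcome is
-- again an adjacency matrix. `numberP` delivers its list reversed, so the reversals cancel in the
-- end.
matrixP-runs : ∀ {e K adjP} → Σ[ L ∈ ℕ ] ∀ {W} {X : Set} (enc : X → Tree) adj (xs : List X) →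
  length xs ≤ W →
  All (λ x → All (λ y → Runs W e K adjP (cons (enc x) (enc y)) (bit (adj x y))) xs) xs →
  Runs W (2 + e) L (matrixP adjP) (list (List.map enc xs)) (matrix adj (reverse xs))
matrixP-runs = _ , λ {W} {X} enc adj xs len runs →
  consʳ pure (consʳ pure pure)
  ⨾ʳ mapOntoʳ enc (λ t → t) (list (List.map enc xs)) (row adj xs) xs
       (All.map (λ {x} rs →
          consʳ pure (consʳ pure pure)
          ⨾ʳ mapOntoʳ enc bit (enc x) (adj x) xs rs [] len
          ⨾ʳ result (row-bits adj xs x) pure) runs)
       [] len
  ⨾ʳ result (cong list (reversed adj xs)) pure
  where
  row : {X : Set} → (X → X → Bool) → List X → X → Tree
  row adj xs x = list (reverse (List.map (λ y → bit (adj x y)) xs))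

  row-bits : {X : Set} (adj : X → X → Bool) (xs : List X) (x : X) →
    list (List.map bit (reverse (List.map (adj x) xs))) ≡ row adj xs x
  row-bits adj xs x = cong list (trans (List.reverse-map bit (List.map (adj x) xs))
    (cong reverse (sym (List.map-∘ xs))))

  reversed : {X : Set} (adj : X → X → Bool) (xs : List X) →
    List.map (λ t → t) (reverse (List.map (row adj xs) xs)) ≡
    List.map (λ x → list (List.map (λ y → bit (adj x y)) (reverse xs))) (reverse xs)
  reversed adj xs = begin
    List.map (λ t → t) (reverse (List.map (row adj xs) xs))  ≡⟨ List.map-id _ ⟩
    reverse (List.map (row adj xs) xs)                       ≡⟨ List.reverse-map (row adj xs) xs ⟨
    List.map (row adj xs) (reverse xs)                       ≡⟨ List.map-cong (λ x →
      cong list (sym (List.reverse-map (λ y → bit (adj x y)) xs))) (reverse xs) ⟩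
    List.map (λ x → list (List.map (λ y → bit (adj x y)) (reverse xs))) (reverse xs) ∎
    where open ≡-Reasoning

-- Choices of one literal from each clause

module _ {n : ℕ} where

  extendBy : List (List (Literal n)) → List (List (Literal n)) → Literal n → List (List (Literal n))
  extendBy L acc l = List.map (l ∷_) L ʳ++ acc

  expand : List (List (Literal n)) → Clause n → List (List (Literal n))
  expand L c = List.foldl (extendBy L) [] (toList c)

  choices : List (List (Literal n)) → List (Clause n) → List (List (Literal n))
  choices = List.foldl expand

  length-extendBy : ∀ L acc l → length (extendBy L acc l) ≡ length L + length acc
  length-extendBy L acc l =
    trans (List.length-ʳ++ (List.map (l ∷_) L)) (cong (_+ length acc) (List.length-map (l ∷_) L))

  length-expand : ∀ L c → length (expand L c) ≡ 3 * length L
  length-expand L (k ∷ l ∷ m ∷ []) = begin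
    length (extendBy L (extendBy L (extendBy L [] k) l) m)  ≡⟨ length-extendBy L _ m ⟩
    length L + length (extendBy L (extendBy L [] k) l)
      ≡⟨ cong (λ z → length L + z) (length-extendBy L _ l) ⟩
    length L + (length L + length (extendBy L [] k))
      ≡⟨ cong (λ x → length L + (length L + x)) (length-extendBy L [] k) ⟩
    3 * length L                                            ∎
    where open ≡-Reasoning

  length-choices : ∀ L cs → length (choices L cs) ≡ 3 ^ length cs * length L
  length-choices L []       = sym (*-identityˡ _)
  length-choices L (c ∷ cs) = begin
    length (choices (expand L c) cs)       ≡⟨ length-choices (expand L c) cs ⟩
    3 ^ length cs * length (expand L c)    ≡⟨ cong (3 ^ length cs *_) (length-expand L c) ⟩
    3 ^ length cs * (3 * length L)         ≡⟨ sym (*-assoc (3 ^ length cs) 3 _) ⟩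
    3 ^ length cs * 3 * length L           ≡⟨ cong (_* length L) (*-comm (3 ^ length cs) 3) ⟩
    3 ^ length (c ∷ cs) * length L         ∎
    where open ≡-Reasoning

  length≤length-choices : ∀ L cs → length L ≤ length (choices L cs)
  length≤length-choices L cs = ≤-trans
    (≤-trans (≤-reflexive (sym (*-identityˡ _))) (*-monoˡ-≤ (length L) (m^n>0 3 (length cs))))
    (≤-reflexive (sym (length-choices L cs)))

  private
    ∈-extend⁻ : ∀ L acc ls {x} → x ∈ List.foldl (extendBy L) acc ls →
      x ∈ acc ⊎ ∃[ l ] ∃[ y ] l ∈ ls × y ∈ L × x ≡ l ∷ y
    ∈-extend⁻ L acc []       x∈ = inj₁ x∈
    ∈-extend⁻ L acc (l ∷ ls) x∈ with ∈-extend⁻ L (extendBy L acc l) ls x∈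
    ... | inj₂ (k , y , k∈ , y∈ , eq) = inj₂ (k , y , there k∈ , y∈ , eq)
    ... | inj₁ x∈′ with reverseAcc⁻ acc (List.map (l ∷_) L) x∈′
    ...   | inj₁ x∈acc = inj₁ x∈acc
    ...   | inj₂ x∈map = let y , y∈ , eq = ∈-map⁻ (l ∷_) x∈map in inj₂ (l , y , here refl , y∈ , eq)

    ∈-extend⁺ : ∀ L acc ls {x} → x ∈ acc ⊎ ∃[ l ] ∃[ y ] l ∈ ls × y ∈ L × x ≡ l ∷ y →
      x ∈ List.foldl (extendBy L) acc ls
    ∈-extend⁺ L acc []       (inj₁ x∈) = x∈
    ∈-extend⁺ L acc (l ∷ ls) (inj₁ x∈) =
      ∈-extend⁺ L _ ls (inj₁ (reverseAcc⁺ acc (List.map (l ∷_) L) (inj₁ x∈)))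
    ∈-extend⁺ L acc (l ∷ ls) (inj₂ (_ , y , here refl , y∈ , refl)) =
      ∈-extend⁺ L _ ls (inj₁ (reverseAcc⁺ acc (List.map (l ∷_) L) (inj₂ (∈-map⁺ (l ∷_) y∈))))
    ∈-extend⁺ L acc (l ∷ ls) (inj₂ (k , y , there k∈ , y∈ , eq)) =
      ∈-extend⁺ L _ ls (inj₂ (k , y , k∈ , y∈ , eq))

  Meets : List (Literal n) → Clause n → Set
  Meets x c = ∃[ l ] l ∈ toList c × l ∈ x

  -- The length is recorded because it bounds the cost of comparing two labels.
  ∈-choices⁻ : ∀ L cs {x} → x ∈ choices L cs →
    ∃[ y ] y ∈ L × y ⊆ x × All (Meets x) cs × length x ≡ length cs + length y
  ∈-choices⁻ L []       x∈ = _ , x∈ , (λ z∈ → z∈) , [] , refl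
  ∈-choices⁻ L (c ∷ cs) x∈ with ∈-choices⁻ (expand L c) cs x∈
  ... | y , y∈ , y⊆x , meets , len with ∈-extend⁻ L [] (toList c) y∈
  ...   | inj₂ (l , z , l∈ , z∈ , refl) =
    z , z∈ , y⊆x ∘ there , (l , l∈ , y⊆x (here refl)) ∷ meets , trans len (+-suc (length cs) (length z))

  ∈-choices⁺ : ∀ {Q : Literal n → Set} L cs → All (λ c → ∃[ l ] l ∈ toList c × Q l) cs →
    ∃[ y ] y ∈ L × All Q y → ∃[ x ] x ∈ choices L cs × All Q x
  ∈-choices⁺ L []       []                   y = y
  ∈-choices⁺ L (c ∷ cs) ((l , l∈ , q) ∷ qs) (y , y∈ , qy) = ∈-choices⁺ (expand L c) cs qs
    (l ∷ y , ∈-extend⁺ L [] (toList c) (inj₂ (l , y , l∈ , y∈ , refl)) , q ∷ qy)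

choicesTree : ∀ {n} → List (List (Literal n)) → Tree
choicesTree = list ∘ List.map literals

encodeClause : ∀ {n} → Clause n → Tree
encodeClause = list ∘ List.map encodeLiteral ∘ toList

expandP : Program
expandP = cons hd (cons (tl ⨾ tl) nil) ⨾ forEach extendP ⨾ tl
  where
  extendP : Program
  extendP = cons (tl ⨾ hd) (cons (tl ⨾ hd) (cons hd (tl ⨾ tl)) ⨾ mapOnto id ⨾ tl)

expandP-runs : Σ[ K ∈ ℕ ] ∀ {W n} (c : Clause n) L z → 3 ≤ W → length L ≤ W →
  Runs W 2 K expandP (cons (encodeClause c) (cons z (choicesTree L))) (choicesTree (expand L c))
expandP-runs = _ , λ {W} {n} c L z 3≤W len →
  pure
  ⨾ʳ forEachʳ encodeLiteral (cons (choicesTree L) ∘ choicesTree) (extendBy L) (λ _ _ → ⊤)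
       (λ l _ acc _ →
          consʳ pure
            (pure
            ⨾ʳ mapOntoʳ {e = 0} literals literals (encodeLiteral l) (l ∷_) L
                 (All.universal (λ x → pure) L) acc len
            ⨾ʳ pure) , tt)
       (toList c) [] tt (≤-trans (≤-reflexive (length-toList c)) 3≤W)
  ⨾ʳ pure
  where
  length-toList : ∀ {A : Set} {k} (v : Vec A k) → length (toList v) ≡ k
  length-toList []      = refl
  length-toList (x ∷ v) = cong suc (length-toList v)

-- Selecting clauses by a schedule

-- A schedule is consumed one entry per clause and restarts as first ∷ rest
-- when it is exhausted.
module Schedule {A : Set} (first : A) (rest : List A) where

  turn : List A → A × List A
  turn []      = first , rest
  turn (b ∷ s) = b , s

  annotate : {C : Set} → List A → List C → List (C × A)
  annotate s []       = []
  annotate s (c ∷ cs) = (c , proj₁ (turn s)) ∷ annotate (proj₂ (turn s)) cs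

open Schedule using (turn; annotate)

selected : {C : Set} → List (C × Bool) → List C
selected []                = []
selected ((c , true) ∷ cs)  = c ∷ selected cs
selected ((c , false) ∷ cs) = selected cs

bits : List Bool → Tree
bits = list ∘ List.map bit

module _ (first : Bool) (rest : List Bool) where

  advance : ∀ {n} → List Bool × List (List (Literal n)) → Clause n → List Bool × List (List (Literal n))
  advance (s , L) c = proj₂ (turn first rest s) , (Bool.if proj₁ (turn first rest s) then expand L c else L)

  foldl-advance : ∀ {n} s L (φ : Formula n) →
    proj₂ (List.foldl advance (s , L) φ) ≡ choices L (selected (annotate first rest s φ))
  foldl-advance s L []      = refl
  foldl-advance s L (c ∷ φ) with turn first rest s
  ... | true  , s′ = foldl-advance s′ (expand L c) φ
  ... | false , s′ = foldl-advance s′ L φ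

  -- The schedule is part of the program text. Its length is independent of the formula, so it
  -- enters only `K`.
  chooseP : List Bool → Program
  chooseP start =
    cons tl (cons (constant (bits start)) (constant (list (nil ∷ [])))) ⨾ forEach advanceP ⨾ tl
    where
    advanceP : Program
    advanceP = cons hd (cons (if tl ⨾ hd then (tl ⨾ hd) else constant (bits (first ∷ rest))) (tl ⨾ tl))
             ⨾ cons (tl ⨾ hd ⨾ tl) (if tl ⨾ hd ⨾ hd then expandP else (tl ⨾ tl))

  chooseP-runs : ∀ start → Σ[ K ∈ ℕ ] ∀ {W n} (φ : Formula n) → 3 ≤ W → length φ ≤ W →
    length (choices ([] ∷ []) (selected (annotate first rest start φ))) ≤ W →
    Runs W 3 K (chooseP start) (encodeFormula φ)
      (choicesTree (choices ([] ∷ []) (selected (annotate first rest start φ))))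
  chooseP-runs start = _ , λ {W} {n} φ 3≤W len len′ →
    consʳ pure (consʳ (constantʳ (bits start)) (constantʳ (list (nil ∷ []))))
    ⨾ʳ forEachʳ encodeClause (λ { (s , L) → cons (bits s) (choicesTree L) }) advance
         -- The bound is on the final list of choices. Processing a clause never shrinks the list,
         -- so every intermediate list is bounded as well.
         (λ φ (s , L) → length (choices L (selected (annotate first rest s φ))) ≤ W)
         (λ { c φ (s , L) inv →
            (consʳ pure (consʳ (result (restart s) (ifʳ pure pure (constantʳ (bits (first ∷ rest))))) pure)
            ⨾ʳ consʳ pure (result (branch (proj₁ (turn first rest s)) L c)
                 (ifʳ pure (proj₂ expandP-runs c L _ 3≤W (shorter s L c φ inv)) pure)))
            , remaining s L c φ inv })
         φ (start , [] ∷ []) len′ len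
    ⨾ʳ result (cong choicesTree (foldl-advance start ([] ∷ []) φ)) pure
    where
    restart : ∀ s → caseTree (bits s) (bits s) (bits (first ∷ rest)) ≡
              bits (proj₁ (turn first rest s) ∷ proj₂ (turn first rest s))
    restart []      = refl
    restart (b ∷ s) = refl

    branch : ∀ {n} b L (c : Clause n) → caseTree (bit b) (choicesTree (expand L c)) (choicesTree L) ≡
      choicesTree (Bool.if b then expand L c else L)
    branch true  _ _ = refl
    branch false _ _ = refl

    remaining : ∀ {W n} s L (c : Clause n) φ →
      length (choices L (selected (annotate first rest s (c ∷ φ)))) ≤ W →
      length (choices (proj₂ (advance (s , L) c))
        (selected (annotate first rest (proj₁ (advance (s , L) c)) φ))) ≤ W
    remaining s L c φ inv with turn first rest s
    ... | true  , s′ = inv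
    ... | false , s′ = inv

    shorter : ∀ {W n} s L (c : Clause n) φ →
      length (choices L (selected (annotate first rest s (c ∷ φ)))) ≤ W → length L ≤ W
    shorter s L c φ inv = ≤-trans (length≤length-choices L
      (selected (annotate first rest s (c ∷ φ)))) inv

-- The reduction

-- Labels do not identify vertices: a clause with a repeated literal yields the same label at
-- several positions. The complement graph needs the serial numbers to recognise its diagonal.
numbered : ∀ {q n} → ℕ × Label q n → Tree
numbered (k , u) = cons (unary k) (encodeLabel u)

number : {X : Set} → ℕ → List X → List (ℕ × X)
number k []       = []
number k (x ∷ xs) = (k , x) ∷ number (suc k) xs

length-number : ∀ {X : Set} k (xs : List X) → length (number k xs) ≡ length xs
length-number k []       = refl
length-number k (x ∷ xs) = cong suc (length-number (suc k) xs)

∈-number⁻ : ∀ {X : Set} k (xs : List X) {y} → y ∈ number k xs → proj₁ y < k + length xs × proj₂ y ∈ xs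
∈-number⁻ k (x ∷ xs) (here refl) = m<m+n k z<s , here refl
∈-number⁻ k (x ∷ xs) {y} (there y∈)  = let y< , y∈′ = ∈-number⁻ (suc k) xs y∈ in
  subst (proj₁ y <_) (sym (+-suc k (length xs))) y< , there y∈′

numberP : Program
numberP = cons id (cons nil nil)
        ⨾ forEach (cons (cons nil (tl ⨾ hd)) (cons (cons (tl ⨾ hd) hd) (tl ⨾ tl)))
        ⨾ tl

numberP-runs : Σ[ K ∈ ℕ ] ∀ {W q n} (us : List (Label q n)) → length us ≤ W →
  Runs W 1 K numberP (list (List.map encodeLabel us)) (list (List.map numbered (reverse (number 0 us))))
numberP-runs = _ , λ {W} {q} {n} us len →
  consʳ pure (consʳ pure pure)
  ⨾ʳ forEachʳ {e = 0} encodeLabel (λ { (k , acc) → cons (unary k) (list (List.map numbered acc)) })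
       (λ { (k , acc) u → suc k , (k , u) ∷ acc }) (λ _ _ → ⊤)
       (λ u _ acc _ → pure , tt) us (0 , []) tt len
  ⨾ʳ result (cong (list ∘ List.map numbered) (accumulated 0 [] us)) pure
  where
  accumulated : ∀ {X : Set} k (acc : List (ℕ × X)) xs →
    proj₂ (List.foldl (λ { (k , acc) u → suc k , (k , u) ∷ acc }) (k , acc) xs) ≡ number k xs ʳ++ acc
  accumulated k acc []       = refl
  accumulated k acc (x ∷ xs) = accumulated (suc k) ((k , x) ∷ acc) xs

record EdgeRule : Set where
  field
    related      : ∀ {q n} → ℕ × Label q n → ℕ × Label q n → Bool
    program      : Program
    program-runs : Σ[ K ∈ ℕ ] ∀ {W q n} → n ≤ W → q ≤ W → (x y : ℕ × Label q n) → proj₁ x ≤ W →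
      length (proj₂ (proj₂ x)) + length (proj₂ (proj₂ y)) ≤ W →
      Runs W 3 K program (cons (numbered x) (numbered y)) (bit (related x y))

cliqueRule : EdgeRule
cliqueRule = record
  { related      = λ x y → compatible (proj₂ x) (proj₂ y)
  ; program      = cons (hd ⨾ tl) (tl ⨾ tl) ⨾ compatibleP
  ; program-runs = _ , λ n≤W q≤W x y _ len → pure ⨾ʳ proj₂ compatibleP-runs n≤W q≤W (proj₂ x) (proj₂ y) len
  }

independenceRule : EdgeRule
independenceRule = record
  { related      = λ x y → not (proj₁ x ≡ᵇ proj₁ y) ∧ not (compatible (proj₂ x) (proj₂ y))
  ; program      = if cons (hd ⨾ hd) (tl ⨾ hd) ⨾ equalP then nil
                   else (cons (hd ⨾ tl) (tl ⨾ tl) ⨾ compatibleP ⨾ (if id then nil else constant output1))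
  ; program-runs = _ , λ n≤W q≤W x y x≤W len →
      result (caseTree-not-∧ (proj₁ x ≡ᵇ proj₁ y) _)
        (ifʳ (pure ⨾ʳ weaken (s≤s z≤n) (proj₂ equalP-runs _ _ x≤W))
             pure
             (pure
              ⨾ʳ proj₂ compatibleP-runs n≤W q≤W (proj₂ x) (proj₂ y) len
              ⨾ʳ result (caseTree-not (compatible (proj₂ x) (proj₂ y))) (ifʳ pure pure (constantʳ output1))))
  }

module _ {q n : ℕ} (L : Fin q → List (List (Literal n))) where

  labels : List (Fin q) → List (Label q n)
  labels []       = []
  labels (i ∷ is) = List.map (i ,_) (L i) ʳ++ labels is

  ∈-labels⁻ : ∀ is {u} → u ∈ labels is → proj₂ u ∈ L (proj₁ u)
  ∈-labels⁻ (i ∷ is) u∈ with reverseAcc⁻ (labels is) (List.map (i ,_) (L i)) u∈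
  ... | inj₁ u∈′ = ∈-labels⁻ is u∈′
  ... | inj₂ u∈′ with ∈-map⁻ (i ,_) u∈′
  ...   | y , y∈ , refl = y∈

  ∈-labels⁺ : ∀ is {i x} → i ∈ is → x ∈ L i → (i , x) ∈ labels is
  ∈-labels⁺ (i ∷ is) (here refl) x∈ =
    reverseAcc⁺ (labels is) (List.map (i ,_) (L i)) (inj₂ (∈-map⁺ (i ,_) x∈))
  ∈-labels⁺ (i ∷ is) (there i∈)  x∈ =
    reverseAcc⁺ (labels is) (List.map (i ,_) (L i)) (inj₁ (∈-labels⁺ is i∈ x∈))

  length-labels-∷ : ∀ i is → length (labels (i ∷ is)) ≡ length (L i) + length (labels is)
  length-labels-∷ i is = trans (List.length-ʳ++ (List.map (i ,_) (L i)))
    (cong (_+ length (labels is)) (List.length-map (i ,_) (L i)))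

module Reduction {q : ℕ} (first : Subset q) (rest start : List (Subset q)) where

  mask : Fin q → List (Subset q) → List Bool
  mask i = List.map (λ m → Vec.lookup m i)

  part : ∀ {n} → Formula n → Fin q → List (Clause n)
  part φ i = selected (annotate (Vec.lookup first i) (mask i rest) (mask i start) φ)

  partChoices : ∀ {n} → Formula n → Fin q → List (List (Literal n))
  partChoices φ i = choices ([] ∷ []) (part φ i)

  -- The recursion over the parts takes place outside the program, which receives one copy of
  -- `chooseP` per part. Thus q influences the constant but not the exponent.
  labelsP : List (Fin q) → Program
  labelsP []       = nil
  labelsP (i ∷ is) = cons (chooseP (Vec.lookup first i) (mask i rest) (mask i start))
                          (cons (constant (unary (toℕ i))) (labelsP is))
                   ⨾ mapOnto id ⨾ tl

  labelsP-runs : ∀ is → Σ[ K ∈ ℕ ] ∀ {W n} (φ : Formula n) → 3 ≤ W → length φ ≤ W →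
    length (labels (partChoices φ) is) ≤ W →
    Runs W 3 K (labelsP is) (encodeFormula φ) (list (List.map encodeLabel (labels (partChoices φ) is)))
  labelsP-runs []       = _ , λ φ _ _ _ → pure
  labelsP-runs (i ∷ is) = _ , λ φ 3≤W len len′ →
    let len″ = ≤-trans (≤-reflexive (sym (length-labels-∷ (partChoices φ) i is))) len′
        leni = ≤-trans (m≤m+n _ _) len″ in
    consʳ (proj₂ (chooseP-runs _ _ (mask i start)) φ 3≤W len leni)
          (consʳ (constantʳ (unary (toℕ i)))
                 (proj₂ (labelsP-runs is) φ 3≤W len (≤-trans (m≤n+m _ (length (partChoices φ i))) len″)))
    ⨾ʳ weaken (s≤s z≤n) (mapOntoʳ {e = 0} literals encodeLabel (unary (toℕ i)) (i ,_) (partChoices φ i)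
         (All.universal (λ _ → pure) _) (labels (partChoices φ) is) leni)
    ⨾ʳ pure

  vertices : ∀ {n} → Formula n → List (Label q n)
  vertices φ = labels (partChoices φ) (List.allFin q)

  length-selected : {C : Set} (cs : List (C × Bool)) → length (selected cs) ≤ length cs
  length-selected []                = z≤n
  length-selected ((_ , true) ∷ cs)  = s≤s (length-selected cs)
  length-selected ((_ , false) ∷ cs) = m≤n⇒m≤1+n (length-selected cs)

  length-annotate : {A C : Set} (a : A) (as s : List A) (cs : List C) → length (annotate a as s cs) ≡ length cs
  length-annotate a as s []       = refl
  length-annotate a as s (c ∷ cs) = cong suc (length-annotate a as _ cs)

  length-choice : ∀ {n} (φ : Formula n) {u} → u ∈ vertices φ → length (proj₂ u) ≤ length φ
  length-choice φ {u} u∈ with ∈-choices⁻ ([] ∷ []) (part φ (proj₁ u)) (∈-labels⁻ (partChoices φ) (List.allFin q) u∈)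
  ... | _ , here refl , _ , _ , len = ≤-trans (≤-reflexive (trans len (+-identityʳ _)))
    (≤-trans (length-selected (annotate _ _ (mask (proj₁ u) start) φ))
             (≤-reflexive (length-annotate _ _ (mask (proj₁ u) start) φ)))

  module _ (rule : EdgeRule) where
    open EdgeRule rule

    reductionP : Program
    reductionP = labelsP (List.allFin q) ⨾ numberP ⨾ matrixP program

    -- Comparing two labels has exponent 3 and the two loops of the matrix add 2. The bound on
    -- `length φ + length φ` covers the joined list of two choices.
    reductionP-runs : Σ[ K ∈ ℕ ] ∀ {W n} (φ : Formula n) → n ≤ W → q ≤ W → 3 ≤ W →
      length φ + length φ ≤ W → length (vertices φ) ≤ W →
      Runs W 5 K reductionP (encodeFormula φ) (matrix related (number 0 (vertices φ)))
    reductionP-runs = _ , λ {W} φ n≤W q≤W 3≤W len len′ →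
      let xs = number 0 (vertices φ)
          bound : ∀ {x} → x ∈ reverse xs → proj₁ x < length (vertices φ) × proj₂ x ∈ vertices φ
          bound x∈ = ∈-number⁻ 0 (vertices φ) (Any.reverse⁻ x∈) in
      weaken (s≤s (s≤s (s≤s z≤n))) (proj₂ (labelsP-runs (List.allFin q)) φ 3≤W (≤-trans (m≤m+n _ _) len) len′)
      ⨾ʳ weaken (s≤s z≤n) (proj₂ numberP-runs (vertices φ) len′)
      ⨾ʳ result (cong (matrix related) (List.reverse-involutive xs))
           (proj₂ matrixP-runs numbered related (reverse xs)
             (≤-trans (≤-reflexive (trans (List.length-reverse xs) (length-number 0 (vertices φ)))) len′)
             (All.tabulate λ {x} x∈ → All.tabulate λ {y} y∈ →
               proj₂ program-runs n≤W q≤W x y (≤-trans (<⇒≤ (proj₁ (bound x∈))) len′)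
                 (≤-trans (+-mono-≤ (length-choice φ (proj₂ (bound x∈)))
                                     (length-choice φ (proj₂ (bound y∈)))) len)))

-- The graphs

foldl-true⁻ : ∀ {X : Set} {Q : X → Set} (f : Bool → X → Bool) →
  (∀ {b x} → f b x ≡ true → b ≡ true × Q x) →
  ∀ {b} xs → List.foldl f b xs ≡ true → b ≡ true × All Q xs
foldl-true⁻ f step []       eq = eq , []
foldl-true⁻ f step (x ∷ xs) eq =
  let fbx , qs = foldl-true⁻ f step xs eq ; b , q = step fbx in b , q ∷ qs

foldl-true⁺ : ∀ {X : Set} {Q : X → Set} (f : Bool → X → Bool) →
  (∀ {x} → Q x → f true x ≡ true) → ∀ {xs} → All Q xs → List.foldl f true xs ≡ true
foldl-true⁺ f step []               = refl
foldl-true⁺ f step (_∷_ {x} q qs) with f true x | step q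
... | true | refl = foldl-true⁺ f step qs

module _ {n : ℕ} where

  consistent⁻ : (w : List (Literal n)) → consistent w ≡ true →
    ∀ {l l′} → l ∈ w → l′ ∈ w → conflict l′ l ≡ false
  consistent⁻ w eq l∈ l′∈ = All.lookup (All.lookup (proj₂ (foldl-true⁻ (consistentFrom w)
    (λ {b} {l} → foldl-true⁻ (compatibleWith l) (λ {b} {l′} → factors {conflict l′ l}) w) w eq)) l∈) l′∈
    where
    factors : ∀ {a b} → not a ∧ b ≡ true → b ≡ true × a ≡ false
    factors {false} eq = eq , refl

  consistent⁺ : (w : List (Literal n)) →
    (∀ {l l′} → l ∈ w → l′ ∈ w → conflict l′ l ≡ false) → consistent w ≡ true
  consistent⁺ w free = foldl-true⁺ (consistentFrom w)
    (λ {l} → foldl-true⁺ (compatibleWith l) (λ {l′} eq → cong (λ b → not b ∧ true) eq))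
    (All.tabulate λ l∈ → All.tabulate λ l′∈ → free l∈ l′∈)

≡-true-ext : ∀ {a b} → (a ≡ true → b ≡ true) → (b ≡ true → a ≡ true) → a ≡ b
≡-true-ext {true}  {_}     f g = sym (f refl)
≡-true-ext {false} {true}  f g = g refl
≡-true-ext {false} {false} f g = refl

not-true-∧ : ∀ {a b} → a ≡ true → not a ∧ b ≡ false
not-true-∧ refl = refl

≡ᵇ-refl : ∀ k → (k ≡ᵇ k) ≡ true
≡ᵇ-refl k = Equivalence.to T-≡ (≡⇒≡ᵇ k k refl)

≢⇒≡ᵇ-false : ∀ {j k} → j ≢ k → (j ≡ᵇ k) ≡ false
≢⇒≡ᵇ-false {j} {k} j≢k with j ≡ᵇ k in eq
... | false = refl
... | true  = contradiction (≡ᵇ⇒≡ j k (subst Bool.T (sym eq) tt)) j≢k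

≡ᵇ-sym : ∀ j k → (j ≡ᵇ k) ≡ (k ≡ᵇ j)
≡ᵇ-sym zero    zero    = refl
≡ᵇ-sym zero    (suc k) = refl
≡ᵇ-sym (suc j) zero    = refl
≡ᵇ-sym (suc j) (suc k) = ≡ᵇ-sym j k

∈-ʳ++ˡ : ∀ {A : Set} {x : A} xs {ys} → x ∈ xs → x ∈ xs ʳ++ ys
∈-ʳ++ˡ xs {ys} x∈ = reverseAcc⁺ ys xs (inj₂ x∈)

∈-ʳ++ʳ : ∀ {A : Set} {x : A} xs {ys} → x ∈ ys → x ∈ xs ʳ++ ys
∈-ʳ++ʳ xs {ys} x∈ = reverseAcc⁺ ys xs (inj₁ x∈)

∈-ʳ++⁻ : ∀ {A : Set} {x : A} xs {ys} → x ∈ xs ʳ++ ys → x ∈ xs ⊎ x ∈ ys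
∈-ʳ++⁻ xs {ys} x∈ = Sum.swap (reverseAcc⁻ ys xs x∈)

module _ {q n : ℕ} where

  compatible⁻ : (u v : Label q n) → compatible u v ≡ true →
    proj₁ u ≢ proj₁ v × (∀ {l l′} → l ∈ proj₂ u ʳ++ proj₂ v → l′ ∈ proj₂ u ʳ++ proj₂ v → conflict l′ l ≡ false)
  compatible⁻ (i , v) (j , w) eq with toℕ i ≡ᵇ toℕ j in i≡j
  ... | false = (λ { refl → case trans (sym i≡j) (≡ᵇ-refl (toℕ i)) of λ () }) , consistent⁻ (v ʳ++ w) eq

  compatible⁺ : (u v : Label q n) → proj₁ u ≢ proj₁ v →
    (∀ {l l′} → l ∈ proj₂ u ʳ++ proj₂ v → l′ ∈ proj₂ u ʳ++ proj₂ v → conflict l′ l ≡ false) →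
    compatible u v ≡ true
  compatible⁺ (i , v) (j , w) i≢j free
    rewrite ≢⇒≡ᵇ-false (i≢j ∘ Fin.toℕ-injective) = consistent⁺ (v ʳ++ w) free

  compatible-swap : (u v : Label q n) → compatible u v ≡ true → compatible v u ≡ true
  compatible-swap u v eq = let i≢j , free = compatible⁻ u v eq in
    compatible⁺ v u (i≢j ∘ sym) λ l∈ l′∈ → free (swap l∈) (swap l′∈)
    where
    swap : ∀ {l} → l ∈ proj₂ v ʳ++ proj₂ u → l ∈ proj₂ u ʳ++ proj₂ v
    swap l∈ with ∈-ʳ++⁻ (proj₂ v) l∈
    ... | inj₁ l∈v = ∈-ʳ++ʳ (proj₂ u) l∈v
    ... | inj₂ l∈u = ∈-ʳ++ˡ (proj₂ u) l∈u

  cliqueGraph : List (Label q n) → Graph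
  cliqueGraph us = record
    { order       = length us
    ; adjacent    = λ i j → compatible (List.lookup us i) (List.lookup us j)
    ; symmetric   = λ i j → ≡-true-ext (compatible-swap (List.lookup us i) (List.lookup us j))
                                       (compatible-swap (List.lookup us j) (List.lookup us i))
    ; irreflexive = λ i → not-true-∧ (≡ᵇ-refl (toℕ (proj₁ (List.lookup us i))))
    }

complement : Graph → Graph
complement G = record
  { order       = order G
  ; adjacent    = λ u v → not (toℕ u ≡ᵇ toℕ v) ∧ not (adjacent G u v)
  ; symmetric   = λ u v → cong₂ (λ a b → not a ∧ not b) (≡ᵇ-sym (toℕ u) (toℕ v)) (symmetric G u v)
  ; irreflexive = λ u → not-true-∧ (≡ᵇ-refl (toℕ u))
  }

clique⇒independent : ∀ G S → IsClique G S → IsIndependent (complement G) S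
clique⇒independent G S cl u u∈ v v∈ with toℕ u ≡ᵇ toℕ v in eq
... | true  = refl
... | false = cong not (cl u u∈ v v∈ λ { refl → case trans (sym eq) (≡ᵇ-refl (toℕ u)) of λ () })

independent⇒clique : ∀ G S → IsIndependent (complement G) S → IsClique G S
independent⇒clique G S ind u u∈ v v∈ u≢v = not-injective
  (trans (cong (λ b → not b ∧ not (adjacent G u v)) (sym (≢⇒≡ᵇ-false (u≢v ∘ Fin.toℕ-injective)))) (ind u u∈ v v∈))

number≡tabulate : ∀ {X : Set} k (xs : List X) → number k xs ≡ List.tabulate (λ i → k + toℕ i , List.lookup xs i)
number≡tabulate k []       = refl
number≡tabulate k (x ∷ xs) = cong₂ _∷_ (cong (_, x) (sym (+-identityʳ k)))
  (trans (number≡tabulate (suc k) xs)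
    (List.tabulate-cong λ i → cong (_, List.lookup xs i) (sym (+-suc k (toℕ i)))))

matrix-tabulate : ∀ {X : Set} (adj : X → X → Bool) {k} (f : Fin k → X) →
  matrix adj (List.tabulate f) ≡ list (List.tabulate λ u → list (List.tabulate λ v → bit (adj (f u) (f v))))
matrix-tabulate adj f = cong list (trans (List.map-tabulate f _)
  (List.tabulate-cong λ u → cong list (List.map-tabulate f _)))

module _ {q n : ℕ} (us : List (Label q n)) where
  open EdgeRule

  encode-cliqueGraph : matrix (related cliqueRule) (number 0 us) ≡ encodeGraph (cliqueGraph us)
  encode-cliqueGraph = trans (cong (matrix (related cliqueRule)) (number≡tabulate 0 us))
    (matrix-tabulate (related cliqueRule) (λ i → toℕ i , List.lookup us i))

  encode-complement : matrix (related independenceRule) (number 0 us) ≡ encodeGraph (complement (cliqueGraph us))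
  encode-complement = trans (cong (matrix (related independenceRule)) (number≡tabulate 0 us))
    (matrix-tabulate (related independenceRule) (λ i → toℕ i , List.lookup us i))

-- Subsets of Fin k and repetition-free lists

elements : ∀ {k} → Subset k → List (Fin k)
elements []            = []
elements (inside  ∷ S) = zero ∷ List.map suc (elements S)
elements (outside ∷ S) = List.map suc (elements S)

length-elements : ∀ {k} (S : Subset k) → length (elements S) ≡ ∣ S ∣
length-elements []            = refl
length-elements (inside  ∷ S) = cong suc (trans (List.length-map suc (elements S)) (length-elements S))
length-elements (outside ∷ S) = trans (List.length-map suc (elements S)) (length-elements S)

∈-elements⁻ : ∀ {k} (S : Subset k) {i} → i ∈ elements S → i Subset.∈ S
∈-elements⁻ (inside  ∷ S) (here refl) = Vec.here
∈-elements⁻ (inside  ∷ S) (there i∈) with ∈-map⁻ suc i∈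
... | j , j∈ , refl = Vec.there (∈-elements⁻ S j∈)
∈-elements⁻ (outside ∷ S) i∈ with ∈-map⁻ suc i∈
... | j , j∈ , refl = Vec.there (∈-elements⁻ S j∈)

unique-elements : ∀ {k} (S : Subset k) → Unique (elements S)
unique-elements []            = []
unique-elements (inside  ∷ S) = All.map⁺ (All.universal (λ _ ()) (elements S))
                              ∷ Unique.map⁺ Fin.suc-injective (unique-elements S)
unique-elements (outside ∷ S) = Unique.map⁺ Fin.suc-injective (unique-elements S)

fromList : ∀ {k} → List (Fin k) → Subset k
fromList = List.foldr (λ i S → ⁅ i ⁆ ∪ S) Subset.⊥

∈-fromList⁻ : ∀ {k} (is : List (Fin k)) {i} → i Subset.∈ fromList is → i ∈ is
∈-fromList⁻ []       i∈ = contradiction i∈ Subset.∉⊥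
∈-fromList⁻ (j ∷ is) i∈ with Subset.x∈p∪q⁻ ⁅ j ⁆ (fromList is) i∈
... | inj₁ i∈j  = here (Subset.x∈⁅y⁆⇒x≡y j i∈j)
... | inj₂ i∈is = there (∈-fromList⁻ is i∈is)

length≤∣fromList∣ : ∀ {k} {is : List (Fin k)} → Unique is → length is ≤ ∣ fromList is ∣
length≤∣fromList∣ {is = []}     []         = z≤n
length≤∣fromList∣ {is = i ∷ is} (i∉ ∷ uniq) = ≤-trans (s≤s (length≤∣fromList∣ uniq))
  (Subset.p⊂q⇒∣p∣<∣q∣ (Subset.q⊆p∪q ⁅ i ⁆ (fromList is)
    , i , Subset.x∈p∪q⁺ (inj₁ (Subset.x∈⁅x⁆ i))
    , λ i∈ → All.lookup i∉ (∈-fromList⁻ is i∈) refl))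

unique-map : ∀ {A B : Set} (f : A → B) {xs} → Unique xs →
  (∀ {x y} → x ∈ xs → y ∈ xs → x ≢ y → f x ≢ f y) → Unique (List.map f xs)
unique-map f []             inj = []
unique-map f (x∉ ∷ unique) inj =
  All.map⁺ (All.tabulate λ y∈ → inj (here refl) (there y∈) (All.lookup x∉ y∈))
  ∷ unique-map f unique λ x∈ y∈ → inj (there x∈) (there y∈)

-- Satisfying assignments and cliques

open Literal

xor-≢ : ∀ {a b} → a xor b ≡ true → a ≢ b
xor-≢ {true}  {false} _ ()
xor-≢ {false} {true}  _ ()

∈-selected⁺ : ∀ {C : Set} {c : C} cs → (c , true) ∈ cs → c ∈ selected cs
∈-selected⁺ (_ ∷ cs)           (here refl) = here refl
∈-selected⁺ ((_ , true) ∷ cs)  (there c∈)  = there (∈-selected⁺ cs c∈)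
∈-selected⁺ ((_ , false) ∷ cs) (there c∈)  = ∈-selected⁺ cs c∈

∈-selected⁻ : ∀ {C : Set} {c : C} cs → c ∈ selected cs → (c , true) ∈ cs
∈-selected⁻ ((_ , true) ∷ cs)  (here refl) = here refl
∈-selected⁻ ((_ , true) ∷ cs)  (there c∈)  = there (∈-selected⁻ cs c∈)
∈-selected⁻ ((_ , false) ∷ cs) c∈          = there (∈-selected⁻ cs c∈)

∈-annotate : ∀ {A C : Set} {a : A} {as c b} s (cs : List C) → (c , b) ∈ annotate a as s cs → c ∈ cs
∈-annotate s (c ∷ cs) (here refl) = here refl
∈-annotate s (c ∷ cs) (there c∈)  = there (∈-annotate _ cs c∈)

conflict⁻ : ∀ {n} (l l′ : Literal n) → conflict l l′ ≡ true →
  variable-index l ≡ variable-index l′ × polarity l ≢ polarity l′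
conflict⁻ l l′ eq with Equivalence.to T-∧ (Equivalence.from T-≡ eq)
... | same , opposite = Fin.toℕ-injective (≡ᵇ⇒≡ _ _ same) , xor-≢ (Equivalence.to T-≡ opposite)

conflict⁺ : ∀ {n} (l l′ : Literal n) → variable-index l ≡ variable-index l′ →
  polarity l ≡ true → polarity l′ ≡ false → conflict l l′ ≡ true
conflict⁺ (literal i _) (literal .i _) refl refl refl rewrite ≡ᵇ-refl (toℕ i) = refl

true-literals-agree : ∀ {n} (a : Assignment n) {l l′ : Literal n} →
  SatisfiesLiteral a l → SatisfiesLiteral a l′ → conflict l′ l ≡ false
true-literals-agree a {l} {l′} sat sat′ with conflict l′ l in eq
... | false = refl
... | true  = let same , opposite = conflict⁻ l′ l eq in
  contradiction (trans (sym sat′) (trans (cong a same) sat)) opposite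

satisfying : ∀ {n} → List (Literal n) → Assignment n
satisfying w x = any (λ l → polarity l ∧ (toℕ (variable-index l) ≡ᵇ toℕ x)) w

-- A positive literal of `w` is true by construction. A negative one could fail only if `w` also
-- held the positive literal of its variable, and the two would conflict.
satisfying-satisfies : ∀ {n} (w : List (Literal n)) →
  (∀ {l l′} → l ∈ w → l′ ∈ w → conflict l′ l ≡ false) →
  ∀ {l} → l ∈ w → SatisfiesLiteral (satisfying w) l
satisfying-satisfies w free {literal i true} l∈ =
  Equivalence.to T-≡ (Any.any⁺ _ (lose l∈ (≡⇒≡ᵇ (toℕ i) (toℕ i) refl)))
satisfying-satisfies w free {literal i false} l∈ with satisfying w i in eq
... | false = refl
... | true with find (Any.any⁻ (λ l → polarity l ∧ (toℕ (variable-index l) ≡ᵇ toℕ i)) w (Equivalence.from T-≡ eq))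
...   | literal j true , l′∈ , same =
  contradiction (trans (sym (conflict⁺ (literal j true) (literal i false)
    (Fin.toℕ-injective (≡ᵇ⇒≡ (toℕ j) (toℕ i) same)) refl refl)) (free l∈ l′∈)) λ ()

another : ∀ {A : Set} {xs : List A} → Unique xs → 2 ≤ length xs →
  ∀ {x} → x ∈ xs → ∃[ y ] y ∈ xs × x ≢ y
another {xs = _ ∷ []} _ (s≤s ()) _
another {xs = x ∷ y ∷ xs} ((x≢y ∷ _) ∷ _) _ (here refl) = y , there (here refl) , x≢y
another {xs = x ∷ y ∷ xs} (x∉ ∷ _)        _ (there z∈)  = x , here refl , All.lookup x∉ z∈ ∘ sym

module _ {q : ℕ} (first : Subset q) (rest start : List (Subset q)) where
  open Reduction first rest start

  -- Every part has a vertex choosing only literals true under `a`, and literals true under one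
  -- assignment never conflict. The q vertices are distinct because their part indices differ.
  satisfiable⇒clique : ∀ {n} (φ : Formula n) → Satisfiable φ →
    q ≤ cliqueNumber (cliqueGraph (vertices φ))
  satisfiable⇒clique {n} φ (a , sat) = ≤-trans
    (≤-trans (≤-reflexive (sym (trans (List.length-map position (List.allFin q)) (List.length-tabulate λ i → i))))
             (length≤∣fromList∣ (Unique.map⁺ position-injective (Unique.allFin⁺ q))))
    (largest-maximum (isClique? G) S isClique)
    where
    G = cliqueGraph (vertices φ)

    choice : ∀ i → ∃[ x ] x ∈ partChoices φ i × All (SatisfiesLiteral a) x
    choice i = ∈-choices⁺ ([] ∷ []) (part φ i)
      (All.tabulate λ {c} c∈ → find (toList⁺ (All.lookup sat
          (∈-annotate (mask i start) φ (∈-selected⁻ _ c∈)))))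
      ([] , here refl , [])

    label : Fin q → Label q n
    label i = i , proj₁ (choice i)

    label∈ : ∀ i → label i ∈ vertices φ
    label∈ i = ∈-labels⁺ (partChoices φ) (List.allFin q) (∈-allFin i) (proj₁ (proj₂ (choice i)))

    position : Fin q → Fin (order G)
    position i = Any.index (label∈ i)

    lookup-position : ∀ i → List.lookup (vertices φ) (position i) ≡ label i
    lookup-position i = sym (Any.lookup-index (label∈ i))

    position-injective : ∀ {i j} → position i ≡ position j → i ≡ j
    position-injective {i} {j} eq = cong proj₁ (trans (sym (lookup-position i))
      (trans (cong (List.lookup (vertices φ)) eq) (lookup-position j)))

    S : Subset (order G)
    S = fromList (List.map position (List.allFin q))

    agree : ∀ i j {l} → l ∈ proj₂ (label i) ʳ++ proj₂ (label j) → SatisfiesLiteral a l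
    agree i j l∈ with ∈-ʳ++⁻ (proj₂ (label i)) l∈
    ... | inj₁ l∈i = All.lookup (proj₂ (proj₂ (choice i))) l∈i
    ... | inj₂ l∈j = All.lookup (proj₂ (proj₂ (choice j))) l∈j

    isClique : IsClique G S
    isClique u u∈ v v∈ u≢v
      with ∈-map⁻ position (∈-fromList⁻ (List.map position (List.allFin q)) u∈)
         | ∈-map⁻ position (∈-fromList⁻ (List.map position (List.allFin q)) v∈)
    ... | i , _ , refl | j , _ , refl = subst₂ (λ x y → compatible x y ≡ true)
      (sym (lookup-position i)) (sym (lookup-position j))
      (compatible⁺ (label i) (label j) (u≢v ∘ cong position)
        λ l∈ l′∈ → true-literals-agree a (agree i j l∈) (agree i j l′∈))

  -- Consistency is a condition on pairs of literals, so the pairwise consistent choices of a clique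
  -- have a consistent union. `R` is the set of parts the clique visits; it is as large as the
  -- clique because vertices of one part are not adjacent.
  clique⇒satisfying : ∀ {n} (φ : Formula n) → 2 ≤ cliqueNumber (cliqueGraph (vertices φ)) →
    Σ[ a ∈ Assignment n ] Σ[ R ∈ Subset q ] cliqueNumber (cliqueGraph (vertices φ)) ≤ ∣ R ∣ ×
      (∀ {i c} → i Subset.∈ R → c ∈ part φ i → Satisfies a c)
  clique⇒satisfying {n} φ 2≤ω = satisfying w , fromList tags ,
    ≤-trans (≤-reflexive (sym (trans (List.length-map tag us) (length-elements S)))) (length≤∣fromList∣ unique-tags) ,
    λ i∈ c∈ → satisfied-clause (∈-fromList⁻ tags i∈) c∈
    where
    G = cliqueGraph (vertices φ)
    S = largest (isClique? G)
    us = elements S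

    label : Fin (order G) → Label q n
    label = List.lookup (vertices φ)

    tag : Fin (order G) → Fin q
    tag = proj₁ ∘ label

    tags = List.map tag us
    w = List.concatMap (proj₂ ∘ label) us

    pairwise : ∀ {u v} → u ∈ us → v ∈ us → u ≢ v → compatible (label u) (label v) ≡ true
    pairwise u∈ v∈ = largest-satisfies (isClique? G) (λ _ u∈⊥ → contradiction u∈⊥ Subset.∉⊥)
      _ (∈-elements⁻ S u∈) _ (∈-elements⁻ S v∈)

    unique-tags : Unique tags
    unique-tags = unique-map tag (unique-elements S)
      λ {u} {v} u∈ v∈ u≢v → proj₁ (compatible⁻ (label u) (label v) (pairwise u∈ v∈ u≢v))

    -- A label is only compared with other labels, so two literals of the same
    -- label are compared through a second label.
    free′ : ∀ {u v} → u ∈ us → v ∈ us → ∀ {l l′} → l ∈ proj₂ (label u) → l′ ∈ proj₂ (label v) → conflict l′ l ≡ false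
    free′ {u} {v} u∈ v∈ {l} {l′} l∈ l′∈ = cases (u Fin.≟ v)
      where
      cases : Dec (u ≡ v) → conflict l′ l ≡ false
      cases (no u≢v)  = proj₂ (compatible⁻ (label u) (label v) (pairwise u∈ v∈ u≢v))
        (∈-ʳ++ˡ (proj₂ (label u)) l∈) (∈-ʳ++ʳ (proj₂ (label u)) l′∈)
      cases (yes u≡v) =
        let x , x∈ , u≢x = another (unique-elements S) (≤-trans 2≤ω (≤-reflexive (sym (length-elements S)))) u∈
        in proj₂ (compatible⁻ (label u) (label x) (pairwise u∈ x∈ u≢x))
             (∈-ʳ++ˡ (proj₂ (label u)) l∈)
             (∈-ʳ++ˡ (proj₂ (label u)) (subst (λ v → l′ ∈ proj₂ (label v)) (sym u≡v) l′∈))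

    free : ∀ {l l′} → l ∈ w → l′ ∈ w → conflict l′ l ≡ false
    free l∈ l′∈ with find (∈-concatMap⁻ (proj₂ ∘ label) l∈) | find (∈-concatMap⁻ (proj₂ ∘ label) l′∈)
    ... | u , u∈ , l∈u | v , v∈ , l′∈v = free′ u∈ v∈ l∈u l′∈v

    label-meets : ∀ u {c} → c ∈ part φ (tag u) → Meets (proj₂ (label u)) c
    label-meets u c∈ =
      let _ , _ , _ , meets , _ = ∈-choices⁻ ([] ∷ []) (part φ (tag u))
            (∈-labels⁻ (partChoices φ) (List.allFin q) (∈-lookup u))
      in All.lookup meets c∈

    satisfied-clause : ∀ {i c} → i ∈ tags → c ∈ part φ i → Satisfies (satisfying w) c
    satisfied-clause {i} {c} i∈ c∈ =
      let u , u∈ , i≡ = ∈-map⁻ tag i∈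
          l , l∈c , l∈u = label-meets u (subst (λ i → c ∈ part φ i) i≡ c∈)
      in toList⁻ (lose l∈c (satisfying-satisfies w free (∈-concatMap⁺ (proj₂ ∘ label) (lose u∈ l∈u))))

-- Counting along a schedule

indicator : Bool → ℕ
indicator true  = 1
indicator false = 0

count : {A : Set} → (A → Bool) → List A → ℕ
count p []       = 0
count p (x ∷ xs) = indicator (p x) + count p xs

module _ {A : Set} where

  count-++ : ∀ (p : A → Bool) xs ys → count p (xs ++ ys) ≡ count p xs + count p ys
  count-++ p []       ys = refl
  count-++ p (x ∷ xs) ys = trans (cong (λ z → indicator (p x) + z) (count-++ p xs ys))
    (sym (+-assoc (indicator (p x)) (count p xs) (count p ys)))

  count-map : ∀ {B : Set} (p : B → Bool) (f : A → B) xs → count p (List.map f xs) ≡ count (p ∘ f) xs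
  count-map p f []       = refl
  count-map p f (x ∷ xs) = cong (λ z → indicator (p (f x)) + z) (count-map p f xs)

  count-replicate : ∀ (p : A → Bool) k xs → count p (List.concat (List.replicate k xs)) ≡ k * count p xs
  count-replicate p zero    xs = refl
  count-replicate p (suc k) xs = trans (count-++ p xs (List.concat (List.replicate k xs)))
                                    (cong (λ z → count p xs + z) (count-replicate p k xs))

  count-false : ∀ (xs : List A) → count (λ _ → false) xs ≡ 0
  count-false []       = refl
  count-false (_ ∷ xs) = count-false xs

  count-true : ∀ (xs : List A) → count (λ _ → true) xs ≡ length xs
  count-true []       = refl
  count-true (_ ∷ xs) = cong suc (count-true xs)

  count≤length : ∀ (p : A → Bool) xs → count p xs ≤ length xs
  count≤length p []       = z≤n
  count≤length p (x ∷ xs) with p x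
  ... | true  = s≤s (count≤length p xs)
  ... | false = m≤n⇒m≤1+n (count≤length p xs)

  module _ {C : Set} (first : A) (rest : List A) (p : A → Bool) where
    private
      cycle = first ∷ rest
      M = length cycle
      α = count p cycle

      hits : List A → List C → ℕ
      hits s cs = count (p ∘ proj₂) (annotate first rest s cs)

      -- The expected rate is α hits per M entries; the inequality is arranged to avoid subtraction.
      -- The term `M * α` pays for an unfinished pass whose hits all came early.
      Bound : List A → List C → Set
      Bound s cs = M * hits s cs + α * length s ≤ α * length cs + M * count p s + M * α

      rearrange : ∀ M α i h l → M * (i + h) + α * suc l ≡ (M * h + α * l) + (M * i + α)
      rearrange = solve 5 (λ M α i h l → M :* (i :+ h) :+ α :* (con 1 :+ l) :=
                    (M :* h :+ α :* l) :+ (M :* i :+ α)) refl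
        where open +-*-Solver

      rearrange′ : ∀ M α i k c → (α * k + M * c + M * α) + (M * i + α) ≡ α * suc k + M * (i + c) + M * α
      rearrange′ = solve 5 (λ M α i k c → (α :* k :+ M :* c :+ M :* α) :+ (M :* i :+ α) :=
                     α :* (con 1 :+ k) :+ M :* (i :+ c) :+ M :* α) refl
        where open +-*-Solver

      step : ∀ b s c cs → Bound s cs → Bound (b ∷ s) (c ∷ cs)
      step b s c cs bound = begin
        M * hits (b ∷ s) (c ∷ cs) + α * suc (length s)
          ≡⟨ rearrange M α (indicator (p b)) (hits s cs) (length s) ⟩
        (M * hits s cs + α * length s) + (M * indicator (p b) + α)  ≤⟨ +-monoˡ-≤ _ bound ⟩
        (α * length cs + M * count p s + M * α) + (M * indicator (p b) + α)
                                                                    ≡⟨ rearrange′ M α (indicator (p b)) (length cs) (count p s) ⟩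
        α * suc (length cs) + M * count p (b ∷ s) + M * α           ∎
        where open ≤-Reasoning

    -- An amortised count: the potential α |s| − M count p s of the remaining
    -- schedule s vanishes both at the start and at the end of each cycle.
    hits-bound : ∀ s cs → length s ≤ M → Bound s cs
    hits-bound s       []       s≤M = begin
      M * 0 + α * length s                ≡⟨ cong (_+ α * length s) (*-zeroʳ M) ⟩
      α * length s                        ≤⟨ *-monoʳ-≤ α s≤M ⟩
      α * M                               ≡⟨ *-comm α M ⟩
      M * α                               ≤⟨ m≤n+m (M * α) (α * 0 + M * count p s) ⟩
      α * 0 + M * count p s + M * α       ∎
      where open ≤-Reasoning
    hits-bound (b ∷ s) (c ∷ cs) s≤M = step b s c cs (hits-bound s cs (≤-trans (n≤1+n _) s≤M))
    hits-bound []      (c ∷ cs) s≤M = begin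
      M * hits cycle (c ∷ cs) + α * 0
        ≡⟨ trans (cong (λ z → M * hits cycle (c ∷ cs) + z) (*-zeroʳ α)) (+-identityʳ _) ⟩
      M * hits cycle (c ∷ cs)                   ≤⟨ +-cancelʳ-≤ (α * M) _ _ (≤-trans
                                                     (step first rest c cs (hits-bound rest cs (n≤1+n _)))
                                                     (≤-reflexive (shuffle M α (length (c ∷ cs))))) ⟩
      α * length (c ∷ cs) + M * 0 + M * α       ∎
      where
      open ≤-Reasoning
      shuffle : ∀ M α k → α * k + M * α + M * α ≡ α * k + M * 0 + M * α + α * M
      shuffle = solve 3 (λ M α k → α :* k :+ M :* α :+ M :* α := α :* k :+ M :* con 0 :+ M :* α :+ α :* M) refl
        where open +-*-Solver

-- The design of the masks

-- The (suc b)^q masks are distributed as if every i belonged to a mask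
-- independently with probability 1/(suc b).

masks : ℕ → ∀ q → List (Subset q)
masks b zero    = [] ∷ []
masks b (suc q) = List.map (inside ∷_) (masks b q)
               ++ List.concat (List.replicate b (List.map (outside ∷_) (masks b q)))

count-masks : ∀ b q (p : Subset (suc q) → Bool) →
  count p (masks b (suc q)) ≡ count (p ∘ (inside ∷_)) (masks b q) + b * count (p ∘ (outside ∷_)) (masks b q)
count-masks b q p = trans (count-++ p (List.map (inside ∷_) (masks b q)) _) (cong₂ _+_
  (count-map p (inside ∷_) (masks b q))
  (trans (count-replicate p b _) (cong (b *_) (count-map p (outside ∷_) (masks b q)))))

length-masks : ∀ b q → length (masks b (suc q)) ≡ suc b * length (masks b q)
length-masks b q = trans (sym (count-true (masks b (suc q))))
  (trans (count-masks b q (λ _ → true)) (cong (λ x → x + b * x) (count-true (masks b q))))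

masks-nonempty : ∀ b q → Σ[ first ∈ Subset q ] Σ[ rest ∈ List (Subset q) ] masks b q ≡ first ∷ rest
masks-nonempty b zero    = [] , [] , refl
masks-nonempty b (suc q) with masks b q | masks-nonempty b q
... | _ | first , rest , refl = inside ∷ first , _ , refl

count-lookup : ∀ b {q} (i : Fin q) →
  count (λ m → Vec.lookup m i) (masks b q) * suc b ≡ length (masks b q)
count-lookup b {suc q} zero = begin
  count (λ m → Vec.lookup m zero) (masks b (suc q)) * suc b  ≡⟨ cong (_* suc b) (count-masks b q _) ⟩
  (count (λ _ → true) (masks b q) + b * count (λ _ → false) (masks b q)) * suc b
    ≡⟨ cong₂ (λ x y → (x + b * y) * suc b) (count-true (masks b q)) (count-false (masks b q)) ⟩
  (length (masks b q) + b * 0) * suc b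
    ≡⟨ cong (λ x → (length (masks b q) + x) * suc b) (*-zeroʳ b) ⟩
  (length (masks b q) + 0) * suc b
    ≡⟨ cong (_* suc b) (+-identityʳ (length (masks b q))) ⟩
  length (masks b q) * suc b                                 ≡⟨ *-comm (length (masks b q)) (suc b) ⟩
  suc b * length (masks b q)                                 ≡⟨ length-masks b q ⟨
  length (masks b (suc q))                                   ∎
  where open ≡-Reasoning
count-lookup b {suc q} (suc i) = begin
  count (λ m → Vec.lookup m (suc i)) (masks b (suc q)) * suc b  ≡⟨ cong (_* suc b) (count-masks b q _) ⟩
  suc b * count (λ m → Vec.lookup m i) (masks b q) * suc b
    ≡⟨ *-assoc (suc b) (count (λ m → Vec.lookup m i) (masks b q)) (suc b) ⟩
  suc b * (count (λ m → Vec.lookup m i) (masks b q) * suc b)    ≡⟨ cong (suc b *_) (count-lookup b i) ⟩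
  suc b * length (masks b q)                                    ≡⟨ length-masks b q ⟨
  length (masks b (suc q))                                      ∎
  where open ≡-Reasoning

disjoint : ∀ {q} → Subset q → Subset q → Bool
disjoint []      []      = true
disjoint (x ∷ R) (y ∷ m) = not (x ∧ y) ∧ disjoint R m

disjoint⁻ : ∀ {q} (R m : Subset q) → disjoint R m ≡ false → ∃[ i ] i Subset.∈ R × Vec.lookup m i ≡ true
disjoint⁻ []            []            ()
disjoint⁻ (inside  ∷ R) (inside  ∷ m) eq = zero , Vec.here , refl
disjoint⁻ (inside  ∷ R) (outside ∷ m) eq = let i , i∈ , eq′ = disjoint⁻ R m eq in suc i , Vec.there i∈ , eq′
disjoint⁻ (outside ∷ R) (_       ∷ m) eq = let i , i∈ , eq′ = disjoint⁻ R m eq in suc i , Vec.there i∈ , eq′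

-- A coordinate in `R` must avoid one of `suc b` letters and the other coordinates are free. The
-- fraction of masks missing `R` is therefore (1 - 1/B)^|R| with B = b + 1, written here without
-- denominators.
count-disjoint : ∀ b {q} (R : Subset q) →
  count (disjoint R) (masks b q) * suc b ^ ∣ R ∣ ≡ b ^ ∣ R ∣ * length (masks b q)
count-disjoint b []                    = refl
count-disjoint b {suc q} (inside ∷ R)  = begin
  count (disjoint (inside ∷ R)) (masks b (suc q)) * (B * B ^ k)
    ≡⟨ cong (_* (B * B ^ k)) (count-masks b q _) ⟩
  (count (λ _ → false) (masks b q) + b * c) * (B * B ^ k)
    ≡⟨ cong (λ x → (x + b * c) * (B * B ^ k)) (count-false (masks b q)) ⟩
  b * c * (B * B ^ k)
    ≡⟨ solve 4 (λ b c B x → b :* c :* (B :* x) := b :* B :* (c :* x)) refl b c B (B ^ k) ⟩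
  b * B * (c * B ^ k)                                            ≡⟨ cong (b * B *_) (count-disjoint b R) ⟩
  b * B * (b ^ k * length (masks b q))
    ≡⟨ solve 4 (λ b B x m → b :* B :* (x :* m) := b :* x :* (B :* m)) refl b B (b ^ k) (length (masks b q)) ⟩
  b * b ^ k * (B * length (masks b q))
    ≡⟨ cong (b * b ^ k *_) (length-masks b q) ⟨
  b ^ suc k * length (masks b (suc q))                           ∎
  where
  open ≡-Reasoning
  open +-*-Solver
  B = suc b
  k = ∣ R ∣
  c = count (disjoint R) (masks b q)
count-disjoint b {suc q} (outside ∷ R) = begin
  count (disjoint (outside ∷ R)) (masks b (suc q)) * B ^ k  ≡⟨ cong (_* B ^ k) (count-masks b q _) ⟩
  B * c * B ^ k                                             ≡⟨ *-assoc B c (B ^ k) ⟩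
  B * (c * B ^ k)                                           ≡⟨ cong (B *_) (count-disjoint b R) ⟩
  B * (b ^ k * length (masks b q))
    ≡⟨ solve 3 (λ B x m → B :* (x :* m) := x :* (B :* m)) refl B (b ^ k) (length (masks b q)) ⟩
  b ^ k * (B * length (masks b q))                          ≡⟨ cong (b ^ k *_) (length-masks b q) ⟨
  b ^ k * length (masks b (suc q))                          ∎
  where
  open ≡-Reasoning
  open +-*-Solver
  B = suc b
  k = ∣ R ∣
  c = count (disjoint R) (masks b q)

-- Exponential decay of the missed fraction

^-distribʳ-* : ∀ k m n → (m * n) ^ k ≡ m ^ k * n ^ k
^-distribʳ-* zero    m n = refl
^-distribʳ-* (suc k) m n = trans (cong (m * n *_) (^-distribʳ-* k m n))
  (solve 4 (λ m n x y → m :* n :* (x :* y) := m :* x :* (n :* y)) refl m n (m ^ k) (n ^ k))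
  where open +-*-Solver

-- Bernoulli's inequality (1 + 1/b)^k ≥ 1 + k/b at k = b + 1 gives (1 - 1/B)^B ≤ 1/2 for B = b + 1.
-- Dividing by b leaves b = 0 as a separate case.
double-power : ∀ b → 2 * b ^ suc b ≤ suc b ^ suc b
double-power zero        = z≤n
double-power b@(suc _) = *-cancelˡ-≤ b (≤-trans (≤-trans
    (≤-reflexive (solve 2 (λ b x → b :* (con 2 :* x) := (b :+ b) :* x) refl b (b ^ suc b)))
    (*-monoˡ-≤ (b ^ suc b) (+-monoʳ-≤ b (n≤1+n b))))
  (bernoulli (suc b)))
  where
  open +-*-Solver
  bernoulli : ∀ k → (b + k) * b ^ k ≤ b * suc b ^ k
  bernoulli zero    = ≤-reflexive (trans (*-identityʳ _) (trans (+-identityʳ b) (sym (*-identityʳ b))))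
  bernoulli (suc k) = begin
    (b + suc k) * (b * b ^ k)
      ≡⟨ solve 3 (λ b k x → (b :+ (con 1 :+ k)) :* (b :* x) := (b :* b :+ b :+ k :* b) :* x) refl b k (b ^ k) ⟩
    (b * b + b + k * b) * b ^ k      ≤⟨ *-monoˡ-≤ (b ^ k) (m≤m+n (b * b + b + k * b) k) ⟩
    (b * b + b + k * b + k) * b ^ k
      ≡⟨ solve 3 (λ b k x → (b :* b :+ b :+ k :* b :+ k) :* x := (con 1 :+ b) :* ((b :+ k) :* x)) refl b k (b ^ k) ⟩
    suc b * ((b + k) * b ^ k)        ≤⟨ *-monoʳ-≤ (suc b) (bernoulli k) ⟩
    suc b * (b * suc b ^ k)
      ≡⟨ solve 2 (λ b x → (con 1 :+ b) :* (b :* x) := b :* ((con 1 :+ b) :* x)) refl b (suc b ^ k) ⟩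
    b * suc b ^ suc k                ∎
    where open ≤-Reasoning

-- Every block of B = b + 1 factors halves the missed fraction, and k contains ℓ such blocks; the
-- remaining factors only help.
power-gap : ∀ b ℓ k → suc b * ℓ ≤ k → 2 ^ ℓ * b ^ k ≤ suc b ^ k
power-gap b ℓ k Bℓ≤k = subst (λ k → 2 ^ ℓ * b ^ k ≤ B ^ k) (m+[n∸m]≡n Bℓ≤k) (begin
  2 ^ ℓ * b ^ (B * ℓ + j)
    ≡⟨ cong (2 ^ ℓ *_) (trans (^-distribˡ-+-* b (B * ℓ) j) (cong (_* b ^ j) (sym (^-*-assoc b B ℓ)))) ⟩
  2 ^ ℓ * ((b ^ B) ^ ℓ * b ^ j)    ≡⟨ *-assoc (2 ^ ℓ) _ _ ⟨
  2 ^ ℓ * (b ^ B) ^ ℓ * b ^ j      ≡⟨ cong (_* b ^ j) (^-distribʳ-* ℓ 2 (b ^ B)) ⟨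
  (2 * b ^ B) ^ ℓ * b ^ j          ≤⟨ *-mono-≤ (^-monoˡ-≤ ℓ (double-power b)) (^-monoˡ-≤ j (n≤1+n b)) ⟩
  (B ^ B) ^ ℓ * B ^ j
    ≡⟨ trans (^-distribˡ-+-* B (B * ℓ) j) (cong (_* B ^ j) (sym (^-*-assoc B B ℓ))) ⟨
  B ^ (B * ℓ + j)                  ∎)
  where
  open ≤-Reasoning
  B = suc b
  j = k ∸ suc b * ℓ

-- Sizes of the parts and missed clauses

length-selected≡count : ∀ {C : Set} (cs : List (C × Bool)) → length (selected cs) ≡ count proj₂ cs
length-selected≡count []                = refl
length-selected≡count ((_ , true) ∷ cs)  = cong suc (length-selected≡count cs)
length-selected≡count ((_ , false) ∷ cs) = length-selected≡count cs

-- Connects two views of the schedule: the program for part i sees the i-th coordinates of the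
-- masks, while the counting treats the masks as wholes.
annotate-map : ∀ {A B C : Set} (f : A → B) a as s (cs : List C) →
  annotate (f a) (List.map f as) (List.map f s) cs ≡ List.map (λ (c , x) → c , f x) (annotate a as s cs)
annotate-map f a as s       []       = refl
annotate-map f a as []      (c ∷ cs) = cong ((c , f a) ∷_) (annotate-map f a as as cs)
annotate-map f a as (x ∷ s) (c ∷ cs) = cong ((c , f x) ∷_) (annotate-map f a as s cs)

satisfied-bound : ∀ {n} {A : Set} (a : Assignment n) (missed : A → Bool) first rest s (φ : Formula n) →
  (∀ {c m} → (c , m) ∈ annotate first rest s φ → missed m ≡ false → Satisfies a c) →
  length φ ≤ satisfied a φ + count (missed ∘ proj₂) (annotate first rest s φ)
satisfied-bound a missed first rest s []      sat = z≤n
satisfied-bound {A = A} a missed first rest s (c ∷ φ) sat =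
  cases (satisfies? a c) (sat (here refl)) (satisfied-bound a missed first rest _ φ (sat ∘ there))
  where
  m = proj₁ (turn first rest s)
  k = count (missed ∘ proj₂) (annotate first rest (proj₂ (turn first rest s)) φ)

  cases : Dec (Satisfies a c) → (missed m ≡ false → Satisfies a c) → length φ ≤ satisfied a φ + k →
    suc (length φ) ≤ satisfied a (c ∷ φ) + (indicator (missed m) + k)
  cases (yes p) _ ih = ≤-trans (s≤s (≤-trans ih (+-monoʳ-≤ (satisfied a φ) (m≤n+m k (indicator (missed m))))))
    (≤-reflexive (cong (λ xs → length xs + (indicator (missed m) + k)) (sym (List.filter-accept (satisfies? a) p))))
  cases (no ¬p) sat ih with missed m
  ... | false = contradiction (sat refl) ¬p
  ... | true  = ≤-trans (s≤s ih) (≤-reflexive (trans (sym (+-suc (satisfied a φ) k))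
    (cong (λ xs → length xs + suc k) (sym (List.filter-reject (satisfies? a) ¬p)))))

disjoint-full : ∀ {q} (R : Subset q) → 1 ≤ ∣ R ∣ → disjoint R Subset.⊤ ≡ false
disjoint-full (inside  ∷ R) _   = refl
disjoint-full (outside ∷ R) 1≤R = disjoint-full R 1≤R

count-replicate-false : ∀ {A : Set} (p : A → Bool) {x} → p x ≡ false → ∀ k → count p (List.replicate k x) ≡ 0
count-replicate-false p eq zero    = refl
count-replicate-false p eq (suc k) = cong₂ (λ b c → indicator b + c) eq (count-replicate-false p eq k)

length-labels-bound : ∀ {q n} (L : Fin q → List (List (Literal n))) {k} → (∀ i → length (L i) ≤ k) →
  ∀ is → length (labels L is) ≤ length is * k
length-labels-bound L L≤ []       = z≤n
length-labels-bound L L≤ (i ∷ is) = ≤-trans (≤-reflexive (length-labels-∷ L i is))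
  (+-mono-≤ (L≤ i) (length-labels-bound L L≤ is))

module Instance (b q : ℕ) where

  first : Subset q
  first = proj₁ (masks-nonempty b q)

  rest : List (Subset q)
  rest = proj₁ (proj₂ (masks-nonempty b q))

  cycle-masks : masks b q ≡ first ∷ rest
  cycle-masks = proj₂ (proj₂ (masks-nonempty b q))

  M : ℕ
  M = suc (length rest)

  M-masks : length (masks b q) ≡ M
  M-masks = cong length cycle-masks

  -- The first M clauses are put in every part.  This pays for the clauses
  -- missed in the last, incomplete cycle.
  warmUp : List (Subset q)
  warmUp = List.replicate M Subset.⊤

  open Reduction first rest warmUp public

  choosing : ∀ {n} → Formula n → Fin q → List (Clause n × Bool)
  choosing φ i = annotate (Vec.lookup first i) (mask i rest) (mask i warmUp) φ

  private
    module _ {n} (φ : Formula n) (p : Subset q → Bool) where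
      hits : ℕ
      hits = count (p ∘ proj₂) (annotate first rest warmUp φ)

      bound : M * hits ≤ count p (masks b q) * length φ + M * count p warmUp
      -- `warmUp` has length M, so the term `α * length warmUp` equals the additive error allowed by
      -- `hits-bound`, and the two cancel.
      bound = +-cancelʳ-≤ (M * α) _ _ (begin
        M * hits + M * α
          ≡⟨ cong (λ z → M * hits + z) (trans (*-comm M α) (cong (α *_) (sym (List.length-replicate M)))) ⟩
        M * hits + α * length warmUp
          ≤⟨ hits-bound first rest p warmUp φ (≤-reflexive (List.length-replicate M)) ⟩
        α * length φ + M * count p warmUp + M * α
          ≡⟨ cong (λ ms → count p ms * length φ + M * count p warmUp + M * α) cycle-masks ⟨
        count p (masks b q) * length φ + M * count p warmUp + M * α ∎)
        where
        open ≤-Reasoning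
        α = count p (first ∷ rest)

  -- By `count-lookup` the part receives its share 1/B of the clauses; the warm-up adds at most M
  -- more.
  length-part : ∀ {n} (φ : Formula n) i → length (part φ i) * suc b ≤ length φ + M * suc b
  length-part φ i = *-cancelˡ-≤ M (begin
    M * (length (part φ i) * B)          ≡⟨ cong (λ x → M * (x * B)) length≡hits ⟩
    M * (hits φ p * B)                   ≡⟨ *-assoc M (hits φ p) B ⟨
    M * hits φ p * B                     ≤⟨ *-monoˡ-≤ B (bound φ p) ⟩
    (α * length φ + M * count p warmUp) * B ≤⟨ *-monoˡ-≤ B (+-monoʳ-≤ (α * length φ) (*-monoʳ-≤ M
                                               (≤-trans (count≤length p warmUp) (≤-reflexive (List.length-replicate M))))) ⟩
    (α * length φ + M * M) * B
      ≡⟨ solve 4 (λ α l M B → (α :* l :+ M :* M) :* B := α :* B :* l :+ M :* (M :* B)) refl α (length φ) M B ⟩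
    α * B * length φ + M * (M * B)
      ≡⟨ cong (λ x → x * length φ + M * (M * B)) (trans (count-lookup b i) M-masks) ⟩
    M * length φ + M * (M * B)           ≡⟨ *-distribˡ-+ M (length φ) (M * B) ⟨
    M * (length φ + M * B)               ∎)
    where
    open ≤-Reasoning
    open +-*-Solver using (solve; _:+_; _:*_; _:=_)
    B = suc b
    p = λ (m : Subset q) → Vec.lookup m i
    α = count p (masks b q)

    length≡hits : length (part φ i) ≡ hits φ p
    length≡hits = trans (length-selected≡count (choosing φ i)) (trans (cong (count proj₂) (annotate-map p first rest warmUp φ))
      (count-map proj₂ _ (annotate first rest warmUp φ)))

  -- An additive constant would spoil the gap on short formulas. There is none because the warm-up
  -- masks are full and hence meet every nonempty `R`.
  missed-bound : ∀ {n} (φ : Formula n) ℓ (R : Subset q) → 1 ≤ ∣ R ∣ → suc b * ℓ ≤ ∣ R ∣ →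
    count (disjoint R ∘ proj₂) (annotate first rest warmUp φ) * 2 ^ ℓ ≤ length φ
  missed-bound φ ℓ R 1≤R Bℓ≤R = *-cancelˡ-≤ (B ^ k) {{m^n≢0 B k}} (*-cancelˡ-≤ M (begin
    M * (B ^ k * (h * 2 ^ ℓ))
      ≡⟨ solve 4 (λ M x h y → M :* (x :* (h :* y)) := M :* h :* (x :* y)) refl M (B ^ k) h (2 ^ ℓ) ⟩
    M * h * (B ^ k * 2 ^ ℓ)            ≤⟨ *-monoˡ-≤ (B ^ k * 2 ^ ℓ) (bound φ (disjoint R)) ⟩
    (α * length φ + M * count (disjoint R) warmUp) * (B ^ k * 2 ^ ℓ)
      ≡⟨ cong (λ x → (α * length φ + M * x) * (B ^ k * 2 ^ ℓ)) (count-replicate-false (disjoint R) (disjoint-full R 1≤R) M) ⟩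
    (α * length φ + M * 0) * (B ^ k * 2 ^ ℓ)
      ≡⟨ solve 5 (λ α l M x y → (α :* l :+ M :* con 0) :* (x :* y) := y :* (α :* x) :* l) refl α (length φ) M (B ^ k) (2 ^ ℓ) ⟩
    2 ^ ℓ * (α * B ^ k) * length φ
      ≡⟨ cong (λ x → 2 ^ ℓ * x * length φ) (trans (count-disjoint b R) (cong (b ^ k *_) M-masks)) ⟩
    2 ^ ℓ * (b ^ k * M) * length φ     ≡⟨ cong (_* length φ) (*-assoc (2 ^ ℓ) (b ^ k) M) ⟨
    2 ^ ℓ * b ^ k * M * length φ       ≤⟨ *-monoˡ-≤ (length φ) (*-monoˡ-≤ M (power-gap b ℓ k Bℓ≤R)) ⟩
    B ^ k * M * length φ
      ≡⟨ solve 3 (λ x M l → x :* M :* l := M :* (x :* l)) refl (B ^ k) M (length φ) ⟩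
    M * (B ^ k * length φ)             ∎))
    where
    open ≤-Reasoning
    open +-*-Solver using (solve; _:+_; _:*_; _:=_; con)
    B = suc b
    k = ∣ R ∣
    h = hits φ (disjoint R)
    α = count (disjoint R) (masks b q)

  clique⇒mostly-satisfied : ∀ {n} (φ : Formula n) ℓ {r} → 2 ≤ r → suc b * ℓ ≤ r →
    r ≤ cliqueNumber (cliqueGraph (vertices φ)) →
    Σ[ a ∈ Assignment n ] ∃[ h ] length φ ≤ satisfied a φ + h × h * 2 ^ ℓ ≤ length φ
  clique⇒mostly-satisfied φ ℓ 2≤r Bℓ≤r r≤ω =
    let a , R , ω≤R , sat = clique⇒satisfying first rest warmUp φ (≤-trans 2≤r r≤ω)
        r≤R = ≤-trans r≤ω ω≤R
    in a , _ , satisfied-bound a (disjoint R) first rest warmUp φ (λ {c} {m} cm∈ eq →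
                 let i , i∈ , eq′ = disjoint⁻ R m eq in
                 sat i∈ (∈-selected⁺ (choosing φ i) (subst (λ x → (c , x) ∈ choosing φ i) eq′
                   (subst ((c , Vec.lookup m i) ∈_) (sym (annotate-map (λ m → Vec.lookup m i) first rest warmUp φ))
                     (∈-map⁺ (λ (c , m) → c , Vec.lookup m i) cm∈)))))
             , missed-bound φ ℓ R (≤-trans (≤-trans (s≤s z≤n) 2≤r) r≤R) (≤-trans Bℓ≤r r≤R)

  length-vertices : ∀ {n} (φ : Formula n) {s} → (∀ i → length (part φ i) ≤ s) → length (vertices φ) ≤ q * 3 ^ s
  length-vertices φ {s} part≤ = subst (λ k → length (vertices φ) ≤ k * 3 ^ s) (List.length-tabulate {n = q} (λ i → i))
    (length-labels-bound (partChoices φ) (λ i → ≤-trans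
      (≤-reflexive (trans (length-choices ([] ∷ []) (part φ i)) (*-identityʳ _)))
      (^-monoʳ-≤ 3 (part≤ i))) (List.allFin q))

-- Growth estimates

-- Replaces the extraction of roots: bounds with fractional exponents are proved after raising both
-- sides to a common power.
^-cancelʳ-≤ : ∀ k .{{_ : NonZero k}} {x y} → x ^ k ≤ y ^ k → x ≤ y
^-cancelʳ-≤ k {x} {y} xᵏ≤yᵏ with x ≤? y
... | yes x≤y = x≤y
... | no  x≰y = contradiction (^-monoˡ-< k (≰⇒> x≰y)) (≤⇒≯ xᵏ≤yᵏ)

m≤m^k : ∀ m k .{{_ : NonZero k}} → m ≤ m ^ k
m≤m^k zero      k       = z≤n
m≤m^k m@(suc _) (suc k) = m≤m*n m (m ^ k) {{m^n≢0 m k}}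

^-+-≤ : ∀ k x y → (x + y) ^ k ≤ 2 ^ k * (x ^ k + y ^ k)
^-+-≤ k x y with ≤-total x y
... | inj₁ x≤y = begin
  (x + y) ^ k             ≤⟨ ^-monoˡ-≤ k (+-mono-≤ x≤y (≤-reflexive (sym (+-identityʳ y)))) ⟩
  (2 * y) ^ k             ≡⟨ ^-distribʳ-* k 2 y ⟩
  2 ^ k * y ^ k           ≤⟨ *-monoʳ-≤ (2 ^ k) (m≤n+m (y ^ k) (x ^ k)) ⟩
  2 ^ k * (x ^ k + y ^ k) ∎
  where open ≤-Reasoning
... | inj₂ y≤x = begin
  (x + y) ^ k             ≤⟨ ^-monoˡ-≤ k (+-monoʳ-≤ x (≤-trans y≤x (≤-reflexive (sym (+-identityʳ x))))) ⟩
  (2 * x) ^ k             ≡⟨ ^-distribʳ-* k 2 x ⟩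
  2 ^ k * x ^ k           ≤⟨ *-monoʳ-≤ (2 ^ k) (m≤m+n (x ^ k) (y ^ k)) ⟩
  2 ^ k * (x ^ k + y ^ k) ∎
  where open ≤-Reasoning

suc≤2^ : ∀ n → suc n ≤ 2 ^ n
suc≤2^ zero    = ≤-refl
suc≤2^ (suc n) = begin
  suc (suc n)        ≤⟨ s≤s (suc≤2^ n) ⟩
  1 + 2 ^ n          ≤⟨ +-monoˡ-≤ (2 ^ n) (m^n>0 2 n) ⟩
  2 ^ n + 2 ^ n      ≡⟨ cong (λ z → 2 ^ n + z) (sym (+-identityʳ (2 ^ n))) ⟩
  2 ^ suc n          ∎
  where open ≤-Reasoning

-- Division with remainder gives suc n ≤ k (n/k + 1) ≤ k 2^(n/k); the k-th power of this has the
-- right exponent.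
suc^≤2^ : ∀ k .{{_ : NonZero k}} n → suc n ^ k ≤ k ^ k * 2 ^ n
suc^≤2^ k n = begin
  suc n ^ k                     ≤⟨ ^-monoˡ-≤ k (begin
    suc n                         ≡⟨ cong suc (m≡m%n+[m/n]*n n k) ⟩
    suc (n % k + n / k * k)    ≤⟨ +-monoˡ-≤ (n / k * k) (m%n<n n k) ⟩
    suc (n / k) * k               ≡⟨ *-comm (suc (n / k)) k ⟩
    k * suc (n / k)               ≤⟨ *-monoʳ-≤ k (suc≤2^ (n / k)) ⟩
    k * 2 ^ (n / k)               ∎) ⟩
  (k * 2 ^ (n / k)) ^ k         ≡⟨ ^-distribʳ-* k k (2 ^ (n / k)) ⟩
  k ^ k * (2 ^ (n / k)) ^ k     ≡⟨ cong (k ^ k *_) (^-*-assoc 2 (n / k) k) ⟩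
  k ^ k * 2 ^ (n / k * k)       ≤⟨ *-monoʳ-≤ (k ^ k) (^-monoʳ-≤ 2 (m/n*n≤m n k)) ⟩
  k ^ k * 2 ^ n                 ∎
  where open ≤-Reasoning

3^≤2^ : ∀ k → 3 ^ k ≤ 2 ^ (2 * k)
3^≤2^ k = ≤-trans (^-monoˡ-≤ k (n≤1+n 3)) (≤-reflexive (^-*-assoc 2 2 k))

-- Here d and ℓ are the denominators of the constants δ and ε of Gap-ETH, c is
-- the density of clauses, M is the length of the cycle of masks, and s bounds
-- the number of clauses in a part.
module Parameters (d′ ℓ′ c : ℕ) where

  -- In D′ the 4 is 2 · 2, from 3^k ≤ 2^(2k) and from r ≤ 2ℓB. The 20 in r₀ is 5 · 2 · 2: the
  -- exponent of the reduction, the squaring that separates two factors of its running time, and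
  -- again 3^k ≤ 2^(2k). Taking `suc c` keeps the products positive.
  d ℓ c′ D′ D r₀ : ℕ
  d  = suc d′
  ℓ  = suc ℓ′
  c′ = suc c
  D′ = 4 * (ℓ * c′)
  D  = d * D′
  r₀ = ℓ * (20 * (d * c′))

  -- B is the integer quotient of r by ℓ. As it is positive, rounding down loses at most a factor 2.
  choose-density : ∀ {r} → r₀ ≤ r →
    ∃[ b ] suc b * ℓ ≤ r × r ≤ 2 * (ℓ * suc b) × 20 * (d * c′) ≤ suc b
  choose-density {r} r₀≤r = cases (r / ℓ) lower (m/n*n≤m r ℓ) (m≡m%n+[m/n]*n r ℓ)
    where
    lower : 20 * (d * c′) ≤ r / ℓ
    lower = subst (_≤ r / ℓ)
      (trans (cong (_/ ℓ) (*-comm ℓ (20 * (d * c′)))) (m*n/n≡m (20 * (d * c′)) ℓ)) (/-monoˡ-≤ ℓ r₀≤r)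

    cases : ∀ B → 20 * (d * c′) ≤ B → B * ℓ ≤ r → r ≡ r % ℓ + B * ℓ →
      ∃[ b ] suc b * ℓ ≤ r × r ≤ 2 * (ℓ * suc b) × 20 * (d * c′) ≤ suc b
    cases (suc b) large Bℓ≤r r≡ = b , Bℓ≤r , (begin
      r                            ≡⟨ r≡ ⟩
      r % ℓ + suc b * ℓ            ≤⟨ +-monoˡ-≤ (suc b * ℓ) (<⇒≤ (m%n<n r ℓ)) ⟩
      ℓ + suc b * ℓ                ≤⟨ +-monoˡ-≤ (suc b * ℓ) (m≤m*n ℓ (suc b)) ⟩
      ℓ * suc b + suc b * ℓ
        ≡⟨ cong (λ z → ℓ * suc b + z) (trans (*-comm (suc b) ℓ) (sym (+-identityʳ _))) ⟩
      2 * (ℓ * suc b)              ∎) , large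
      where open ≤-Reasoning

  module _ {b r : ℕ} (r≤2ℓB : r ≤ 2 * (ℓ * suc b)) (B-large : 20 * (d * c′) ≤ suc b)
           (M : ℕ) {m n s : ℕ} (m≤cn : m ≤ c * n) (sB≤ : s * suc b ≤ m + M * suc b) where
    private
      B = suc b
      E = M * B
      open ≤-Reasoning
      open +-*-Solver

    sB-bound : s * B ≤ c′ * (n + E)
    sB-bound = begin
      s * B               ≤⟨ sB≤ ⟩
      m + E               ≤⟨ +-mono-≤ (≤-trans m≤cn (m≤n+m (c * n) n)) (m≤m+n E (c * E)) ⟩
      c′ * n + c′ * E     ≡⟨ *-distribˡ-+ c′ n E ⟨
      c′ * (n + E)        ∎

    20ds-bound : 20 * d * s ≤ n + E
    20ds-bound = *-cancelˡ-≤ c′ (begin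
      c′ * (20 * d * s)
        ≡⟨ solve 3 (λ c d s → c :* (con 20 :* d :* s) := s :* (con 20 :* (d :* c))) refl c′ d s ⟩
      s * (20 * (d * c′))   ≤⟨ *-monoʳ-≤ s B-large ⟩
      s * B                 ≤⟨ sB-bound ⟩
      c′ * (n + E)          ∎)

    sr-bound : 2 * (s * r) ≤ (n + E) * D′
    sr-bound = begin
      2 * (s * r)              ≤⟨ *-monoʳ-≤ 2 (*-monoʳ-≤ s r≤2ℓB) ⟩
      2 * (s * (2 * (ℓ * B)))
        ≡⟨ solve 3 (λ s l B → con 2 :* (s :* (con 2 :* (l :* B))) := con 4 :* l :* (s :* B)) refl s ℓ B ⟩
      4 * ℓ * (s * B)          ≤⟨ *-monoʳ-≤ (4 * ℓ) sB-bound ⟩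
      4 * ℓ * (c′ * (n + E))
        ≡⟨ solve 3 (λ l c x → con 4 :* l :* (c :* x) := x :* (con 4 :* (l :* c))) refl ℓ c′ (n + E) ⟩
      (n + E) * D′             ∎

    -- Since s is about m/B and r at most 2ℓB, the product s r is linear in n whatever r is. So
    -- |V|^r is 2^(O(n)), and the factor D′ of D absorbs the hidden constant, leaving a bound on
    -- `t ^ d`.
    oracle-bound : ∀ {C N q t} → N ≤ q * 3 ^ s → t ^ D ≤ C ^ D * N ^ r →
      t ^ d ≤ C ^ d * q ^ r * 2 ^ E * 2 ^ n
    oracle-bound {C} {N} {q} {t} N≤ t≤ = ^-cancelʳ-≤ D′ (begin
      (t ^ d) ^ D′                           ≡⟨ ^-*-assoc t d D′ ⟩
      t ^ D                                  ≤⟨ t≤ ⟩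
      C ^ D * N ^ r                          ≤⟨ *-monoʳ-≤ (C ^ D) (^-monoˡ-≤ r N≤) ⟩
      C ^ D * (q * 3 ^ s) ^ r
        ≡⟨ cong (C ^ D *_) (trans (^-distribʳ-* r q (3 ^ s)) (cong (q ^ r *_) (^-*-assoc 3 s r))) ⟩
      C ^ D * (q ^ r * 3 ^ (s * r))
        ≤⟨ *-monoʳ-≤ (C ^ D) (*-mono-≤ (m≤m^k (q ^ r) D′) (≤-trans (3^≤2^ (s * r)) (^-monoʳ-≤ 2 sr-bound))) ⟩
      C ^ D * ((q ^ r) ^ D′ * 2 ^ ((n + E) * D′))
        ≡⟨ cong₂ (λ x y → x * ((q ^ r) ^ D′ * y)) (sym (^-*-assoc C d D′)) (sym (^-*-assoc 2 (n + E) D′)) ⟩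
      (C ^ d) ^ D′ * ((q ^ r) ^ D′ * (2 ^ (n + E)) ^ D′)
        ≡⟨ cong ((C ^ d) ^ D′ *_) (^-distribʳ-* D′ (q ^ r) (2 ^ (n + E))) ⟨
      (C ^ d) ^ D′ * (q ^ r * 2 ^ (n + E)) ^ D′ ≡⟨ ^-distribʳ-* D′ (C ^ d) _ ⟨
      (C ^ d * (q ^ r * 2 ^ (n + E))) ^ D′
        ≡⟨ cong (_^ D′) (trans (cong (λ x → C ^ d * (q ^ r * x)) (^-distribˡ-+-* 2 n E))
                                                 (solve 4 (λ a b x y → a :* (b :* (x :* y)) := a :* b :* y :* x) refl (C ^ d) (q ^ r) (2 ^ n) (2 ^ E))) ⟩
      (C ^ d * q ^ r * 2 ^ E * 2 ^ n) ^ D′   ∎)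

    reduction-bound : ∀ {K Q W} → suc W ≤ Q * (3 ^ s * suc n) →
      (K * suc W ^ 5) ^ d ≤ K ^ d * (Q ^ (5 * d) * (2 ^ E * (10 * d) ^ (10 * d))) * 2 ^ n
    reduction-bound {K} {Q} {W} W≤ = begin
      (K * suc W ^ 5) ^ d
        ≡⟨ trans (^-distribʳ-* d K (suc W ^ 5)) (cong (K ^ d *_) (^-*-assoc (suc W) 5 d)) ⟩
      K ^ d * suc W ^ k                           ≤⟨ *-monoʳ-≤ (K ^ d) (^-monoˡ-≤ k W≤) ⟩
      K ^ d * (Q * (3 ^ s * suc n)) ^ k           ≡⟨ cong (K ^ d *_) (^-distribʳ-* k Q _) ⟩
      K ^ d * (Q ^ k * (3 ^ s * suc n) ^ k)       ≤⟨ *-monoʳ-≤ (K ^ d) (*-monoʳ-≤ (Q ^ k) square-root) ⟩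
      K ^ d * (Q ^ k * (F * 2 ^ n))
        ≡⟨ solve 4 (λ a b f z → a :* (b :* (f :* z)) := a :* (b :* f) :* z) refl (K ^ d) (Q ^ k) F (2 ^ n) ⟩
      K ^ d * (Q ^ k * F) * 2 ^ n                 ∎
      where
      k = 5 * d
      F = 2 ^ E * (10 * d) ^ (10 * d)

      double : k * 2 ≡ 10 * d
      double = solve 1 (λ d → con 5 :* d :* con 2 := con 10 :* d) refl d

      cubes : 3 ^ (s * (k * 2)) ≤ 2 ^ E * 2 ^ n
      cubes = begin
        3 ^ (s * (k * 2))        ≤⟨ 3^≤2^ (s * (k * 2)) ⟩
        2 ^ (2 * (s * (k * 2)))
          ≡⟨ cong (2 ^_) (solve 2 (λ s d → con 2 :* (s :* (con 5 :* d :* con 2)) := con 20 :* d :* s) refl s d) ⟩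
        2 ^ (20 * d * s)         ≤⟨ ^-monoʳ-≤ 2 20ds-bound ⟩
        2 ^ (n + E)              ≡⟨ trans (^-distribˡ-+-* 2 n E) (*-comm (2 ^ n) (2 ^ E)) ⟩
        2 ^ E * 2 ^ n            ∎

      linear : suc n ^ (k * 2) ≤ (10 * d) ^ (10 * d) * 2 ^ n
      linear = subst (λ j → suc n ^ j ≤ (10 * d) ^ (10 * d) * 2 ^ n) (sym double) (suc^≤2^ (10 * d) n)

      -- After squaring, the powers of 3^s and of suc n are each at most a constant times 2^n, and
      -- the product 2^n · 2^n is the square of the target.
      square-root : (3 ^ s * suc n) ^ k ≤ F * 2 ^ n
      square-root = ^-cancelʳ-≤ 2 (begin
        ((3 ^ s * suc n) ^ k) ^ 2            ≡⟨ ^-*-assoc (3 ^ s * suc n) k 2 ⟩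
        (3 ^ s * suc n) ^ (k * 2)
          ≡⟨ trans (^-distribʳ-* (k * 2) (3 ^ s) (suc n)) (cong (_* suc n ^ (k * 2)) (^-*-assoc 3 s (k * 2))) ⟩
        3 ^ (s * (k * 2)) * suc n ^ (k * 2)  ≤⟨ *-mono-≤ cubes linear ⟩
        2 ^ E * 2 ^ n * ((10 * d) ^ (10 * d) * 2 ^ n)
          ≡⟨ solve 3 (λ a b z → a :* z :* (b :* z) := a :* b :* (z :* z)) refl (2 ^ E) ((10 * d) ^ (10 * d)) (2 ^ n) ⟩
        F * (2 ^ n * 2 ^ n)                  ≤⟨ *-monoˡ-≤ (2 ^ n * 2 ^ n) (m≤m^k F 2) ⟩
        F ^ 2 * (2 ^ n * 2 ^ n)
          ≡⟨ cong (λ x → F ^ 2 * (2 ^ n * x)) (sym (*-identityʳ (2 ^ n))) ⟩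
        F ^ 2 * (2 ^ n) ^ 2                  ≡⟨ ^-distribʳ-* 2 F (2 ^ n) ⟨
        (F * 2 ^ n) ^ 2                      ∎)

-- Rational side conditions

numerator-positive : ∀ {p} → 0ℚ ℚ.< p → 1 ≤ ℤ.∣ ↥ p ∣
numerator-positive {mkℚ (+ zero)   d _} 0<p with ℚ.positive 0<p
... | ()
numerator-positive {mkℚ (+ suc n)  d _} 0<p = s≤s z≤n
numerator-positive {mkℚ (-[1+ n ]) d _} 0<p with ℚ.positive 0<p
... | ()

-- Built directly in lowest terms so that numerator and denominator compute. At 0 the value is 1.
1/ : ℕ → ℚ
1/ k = mkℚ (+ 1) (pred k) (1-coprimeTo (suc (pred k)))

1/-positive : ∀ k → 0ℚ ℚ.< 1/ k
1/-positive k = ℚ.positive⁻¹ (1/ k)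

-- The numerator of ε is at least 1, so missing a fraction 1/ℓ of the clauses, where ℓ is the
-- denominator, is missing at most a fraction ε.
few-missed : ∀ ε → 0ℚ ℚ.< ε → ∀ {sat h m} → m ≤ sat + h → h * ↧ₙ ε ≤ m →
  ¬ ((+ sat) ℚ./ 1 ℚ.< (1ℚ ℚ.- ε) ℚ.* ((+ m) ℚ./ 1))
few-missed (mkℚ (+ zero) _ _)   0<ε with ℚ.positive 0<ε
... | ()
few-missed (mkℚ (-[1+ n ]) _ _) 0<ε with ℚ.positive 0<ε
... | ()
few-missed ε@(mkℚ (+ k@(suc _)) ℓ′ _) _ {sat} {h} {m} m≤ hℓ≤m =
  λ lt → ℚ.<-irrefl refl (ℚ.<-≤-trans lt (ℚ.toℚᵘ-cancel-≤ (begin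
    toℚᵘ ((1ℚ ℚ.- ε) ℚ.* ((+ m) ℚ./ 1))             ≃⟨ ℚ.toℚᵘ-homo-* (1ℚ ℚ.- ε) ((+ m) ℚ./ 1) ⟩
    toℚᵘ (1ℚ ℚ.- ε) ℚᵘ.* toℚᵘ ((+ m) ℚ./ 1)         ≃⟨ ℚᵘ.*-cong
      (ℚᵘ.≃-trans (ℚ.toℚᵘ-homo-+ 1ℚ (ℚ.- ε)) (ℚᵘ.+-congʳ ℚᵘ.1ℚᵘ (ℚ.toℚᵘ-homo‿- ε)))
      (ℚ.toℚᵘ-fromℚᵘ (ℚᵘ.mkℚᵘ (+ m) 0)) ⟩
    (ℚᵘ.1ℚᵘ ℚᵘ.- toℚᵘ ε) ℚᵘ.* ℚᵘ.mkℚᵘ (+ m) 0       ≤⟨ ℚᵘ.*≤* cross ⟩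
    ℚᵘ.mkℚᵘ (+ sat) 0                               ≃⟨ ℚᵘ.≃-sym (ℚ.toℚᵘ-fromℚᵘ (ℚᵘ.mkℚᵘ (+ sat) 0)) ⟩
    toℚᵘ ((+ sat) ℚ./ 1)                            ∎)))
  where
  open ℚᵘ.≤-Reasoning
  ℓ = suc ℓ′

  natural : ℓ * m ≤ sat * ℓ + k * m
  natural = ≤-trans (*-monoʳ-≤ ℓ m≤) (≤-trans (≤-reflexive (trans (*-comm ℓ (sat + h)) (*-distribʳ-+ ℓ sat h)))
    (+-monoʳ-≤ (sat * ℓ) (≤-trans hℓ≤m (m≤n*m m k))))

  -- What the comparison of unnormalised fractions unfolds to; it is `natural` with `k * m` moved to
  -- the left.
  cross : (((+ 1) ℤ.* (+ ℓ) ℤ.+ (ℤ.- (+ k)) ℤ.* (+ 1)) ℤ.* (+ m)) ℤ.* (+ 1) ℤ.≤ (+ sat) ℤ.* (+ (1 * ℓ * 1))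
  cross = subst₂ ℤ._≤_
    (trans (cong (ℤ._- (+ k) ℤ.* (+ m)) (ℤ.pos-* ℓ m))
      (solve 3 (λ l k m → l :* m :- k :* m := ((con (+ 1) :* l :+ (:- k) :* con (+ 1)) :* m) :* con (+ 1)) refl (+ ℓ) (+ k) (+ m)))
    (trans (cong (ℤ._- (+ k) ℤ.* (+ m)) (trans (ℤ.pos-+ (sat * ℓ) (k * m)) (cong₂ ℤ._+_ (ℤ.pos-* sat ℓ) (ℤ.pos-* k m))))
      (trans (solve 3 (λ x k m → x :+ k :* m :- k :* m := x) refl ((+ sat) ℤ.* (+ ℓ)) (+ k) (+ m))
        (cong (λ x → (+ sat) ℤ.* (+ x)) (sym (trans (*-identityʳ (1 * ℓ)) (*-identityˡ ℓ))))))
    (ℤ.+-monoˡ-≤ (ℤ.- ((+ k) ℤ.* (+ m))) (ℤ.+≤+ natural))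
    where open ℤ.+-*-Solver

-- Deterministic algorithms for the gap problem on 3-SAT

Eval-++ : ∀ {p x y ω ω′ t} → Eval p x ω y ω′ t → ∀ ρ → Eval p x (ω ++ ρ) y (ω′ ++ ρ) t
Eval-++ id                ρ = id
Eval-++ nil               ρ = nil
Eval-++ hd                ρ = hd
Eval-++ tl                ρ = tl
Eval-++ flip              ρ = flip
Eval-++ (cons e f)        ρ = cons (Eval-++ e ρ) (Eval-++ f ρ)
Eval-++ (e ⨾ f)           ρ = Eval-++ e ρ ⨾ Eval-++ f ρ
Eval-++ (if-true e f)     ρ = if-true (Eval-++ e ρ) (Eval-++ f ρ)
Eval-++ (if-false e f)    ρ = if-false (Eval-++ e ρ) (Eval-++ f ρ)
Eval-++ (while-true e f g) ρ = while-true (Eval-++ e ρ) (Eval-++ f ρ) (Eval-++ g ρ)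
Eval-++ (while-false e)   ρ = while-false (Eval-++ e ρ)

length-subsets : ∀ T → length (subsets T) ≡ 2 ^ T
length-subsets zero    = refl
length-subsets (suc T) = begin
  length (List.map (inside ∷_) (subsets T) ++ List.map (outside ∷_) (subsets T))
    ≡⟨ List.length-++ (List.map (inside ∷_) (subsets T)) ⟩
  length (List.map (inside ∷_) (subsets T)) + length (List.map (outside ∷_) (subsets T))
    ≡⟨ cong₂ _+_ (trans (List.length-map _ (subsets T)) (length-subsets T))
                 (trans (List.length-map _ (subsets T)) (trans (length-subsets T) (sym (+-identityʳ _)))) ⟩
  2 ^ suc T ∎
  where open ≡-Reasoning

unique-subsets : ∀ T → Unique (subsets T)
unique-subsets zero    = [] ∷ []
unique-subsets (suc T) = Unique.++⁺ (Unique.map⁺ ∷-injectiveʳ (unique-subsets T))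
  (Unique.map⁺ ∷-injectiveʳ (unique-subsets T)) disjoint-halves
  where
  disjoint-halves : Disjoint (List.map (inside ∷_) (subsets T)) (List.map (outside ∷_) (subsets T))
  disjoint-halves (v∈ , v∈′) with ∈-map⁻ (inside ∷_) v∈ | ∈-map⁻ (outside ∷_) v∈′
  ... | _ , _ , refl | _ , _ , ()

-- Subsets are Boolean vectors, so `subsets T` enumerates all coin sequences, and every one of them
-- is good.
certain : ∀ T {P : Vec Bool T → Set} → (∀ ω → P ω) → Probability≥2/3 T P
certain T P = subsets T , unique-subsets T , All.universal P (subsets T) ,
  ≤-trans (*-monoˡ-≤ (2 ^ T) (n≤1+n 2)) (≤-reflexive (cong (3 *_) (sym (length-subsets T))))

-- From a gap algorithm on graphs to one on 3-SAT

-- Abstracts from whether the clique graph or its complement is produced; in both cases the optimum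
-- is the clique number of the clique graph, so one analysis suffices.
record Target : Set where
  field
    rule        : EdgeRule
    graph       : ∀ {q n} → List (Label q n) → Graph
    opt         : Graph → ℕ
    encodes     : ∀ {q n} (us : List (Label q n)) →
                  matrix (EdgeRule.related rule) (number 0 us) ≡ encodeGraph (graph us)
    order-graph : ∀ {q n} (us : List (Label q n)) → order (graph us) ≡ length us
    opt-graph   : ∀ {q n} (us : List (Label q n)) → opt (graph us) ≡ cliqueNumber (cliqueGraph us)

cliqueTarget : Target
cliqueTarget = record
  { rule        = cliqueRule
  ; graph       = cliqueGraph
  ; opt         = cliqueNumber
  ; encodes     = encode-cliqueGraph
  ; order-graph = λ us → refl
  ; opt-graph   = λ us → refl
  }

independence-complement : ∀ G → independenceNumber (complement G) ≡ cliqueNumber G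
independence-complement G = ≤-antisym
  (largest-maximum (isClique? G) _ (independent⇒clique G _
    (largest-satisfies (isIndependent? (complement G)) λ _ u∈⊥ → contradiction u∈⊥ Subset.∉⊥)))
  (largest-maximum (isIndependent? (complement G)) _ (clique⇒independent G _
    (largest-satisfies (isClique? G) λ _ u∈⊥ → contradiction u∈⊥ Subset.∉⊥)))

independenceTarget : Target
independenceTarget = record
  { rule        = independenceRule
  ; graph       = complement ∘ cliqueGraph
  ; opt         = independenceNumber
  ; encodes     = encode-complement
  ; order-graph = λ us → refl
  ; opt-graph   = λ us → independence-complement (cliqueGraph us)
  }

module _ (target : Target) (δ₀ ε : ℚ) (c : ℕ) (0<δ₀ : 0ℚ ℚ.< δ₀) (0<ε : 0ℚ ℚ.< ε) where
  open Target target
  open Parameters (ℚ.denominator-1 δ₀) (ℚ.denominator-1 ε) c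

  module Construction (q r : ℕ) (q≥r : q ≥ r) (r≥r₀ : r ≥ r₀)
           (b : ℕ) (Bℓ≤r : suc b * ℓ ≤ r) (r≤2ℓB : r ≤ 2 * (ℓ * suc b)) (B-large : 20 * (d * c′) ≤ suc b)
           (gap : GapAlgorithm encodeGraph order opt (1/ D) q r) where

    private
      p = proj₁ gap
      C = proj₁ (proj₂ gap)
      correct = proj₂ (proj₂ gap)

    open Instance b q

    2≤r : 2 ≤ r
    2≤r = ≤-trans (≤-trans (≤-trans (s≤s (s≤s z≤n)) (m≤m*n 20 (d * c′))) (m≤n*m (20 * (d * c′)) ℓ)) r≥r₀

    1≤q : 1 ≤ q
    1≤q = ≤-trans (≤-trans (s≤s z≤n) 2≤r) q≥r

    -- None of these depends on the formula. `Q` collects the coefficients of `suc W` in terms of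
    -- `3 ^ s * suc n`; `C₁` belongs to the reduction and `C₂` to the gap algorithm. The two factors
    -- `2 ^ d` in `C₀` come from splitting the d-th power of 1 + t₁ + t₂ twice.
    K Q E C₁ C₂ C₀ : ℕ
    K  = proj₁ (reductionP-runs rule)
    Q  = q + (1 + (q + (4 + (c + c))))
    E  = M * suc b
    C₁ = K ^ d * (Q ^ (5 * d) * (2 ^ E * (10 * d) ^ (10 * d)))
    C₂ = C ^ d * q ^ r * 2 ^ E
    C₀ = 2 ^ d * (1 + 2 ^ d * (C₁ + C₂))

    module _ {n} (φ : Formula n) (m≤cn : length φ ≤ c * n) where
      private
        m = length φ
        us = vertices φ
        N = length us
        G = graph us
        -- One number above everything that `reductionP-runs` wants bounded; the 3 is the width of a
        -- clause.
        W = N + (n + (q + (3 + (m + m))))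

        s : ℕ
        s = (m + E) / suc b

        sB≤ : s * suc b ≤ m + E
        sB≤ = m/n*n≤m (m + E) (suc b)

        N≤ : N ≤ q * 3 ^ s
        N≤ = length-vertices φ λ i →
          subst (_≤ s) (m*n/n≡m (length (part φ i)) (suc b)) (/-monoˡ-≤ (suc b) (length-part φ i))

        order≤ : 1 ⊔ order G ≤ q * 3 ^ s
        order≤ = ⊔-lub (*-mono-≤ 1≤q (m^n>0 3 s)) (≤-trans (≤-reflexive (order-graph us)) N≤)

        W≤ : suc W ≤ Q * (3 ^ s * suc n)
        W≤ = begin
          suc W
            ≡⟨ solve 4 (λ N n q m → con 1 :+ (N :+ (n :+ (q :+ (con 3 :+ (m :+ m))))) :=
                                                              N :+ (n :+ (q :+ (con 4 :+ (m :+ m))))) refl N n q m ⟩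
          N + (n + (q + (4 + (m + m))))
            ≤⟨ +-mono-≤ (≤-trans N≤ (*-monoʳ-≤ q X≤Z)) (+-mono-≤ n≤Z (+-mono-≤ (m≤m*n q Z {{Z≢0}})
                                                             (+-mono-≤ (m≤m*n 4 Z {{Z≢0}}) (+-mono-≤ m≤cZ m≤cZ)))) ⟩
          q * Z + (Z + (q * Z + (4 * Z + (c * Z + c * Z))))
            ≡⟨ solve 3 (λ q c Z → q :* Z :+ (Z :+ (q :* Z :+ (con 4 :* Z :+ (c :* Z :+ c :* Z)))) :=
                                                              (q :+ (con 1 :+ (q :+ (con 4 :+ (c :+ c))))) :* Z) refl q c Z ⟩
          Q * Z                                          ∎
          where
          open ≤-Reasoning
          open +-*-Solver
          Z = 3 ^ s * suc n
          Z≢0 : NonZero Z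
          Z≢0 = m*n≢0 (3 ^ s) (suc n) {{m^n≢0 3 s}}
          X≤Z : 3 ^ s ≤ Z
          X≤Z = m≤m*n (3 ^ s) (suc n)
          n≤Z : n ≤ Z
          n≤Z = ≤-trans (n≤1+n n) (m≤n*m (suc n) (3 ^ s) {{m^n≢0 3 s}})
          m≤cZ : m ≤ c * Z
          m≤cZ = ≤-trans m≤cn (*-monoʳ-≤ c n≤Z)

        reduce : Runs W 5 K (reductionP rule) (encodeFormula φ) (encodeGraph G)
        reduce = result (encodes us) (proj₂ (reductionP-runs rule) φ
          (≤-trans (m≤m+n n _) (m≤n+m _ N))
          (≤-trans (≤-trans (m≤m+n q _) (m≤n+m _ n)) (m≤n+m _ N))
          (≤-trans (≤-trans (≤-trans (m≤m+n 3 (m + m)) (m≤n+m _ q)) (m≤n+m _ n)) (m≤n+m _ N))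
          (≤-trans (≤-trans (≤-trans (m≤n+m (m + m) 3) (m≤n+m _ q)) (m≤n+m _ n)) (m≤n+m _ N))
          (m≤m+n N _))

        y = proj₁ (correct G)
        t₁ = K * suc W ^ 5
        t₂ = proj₁ (proj₂ (correct G))
        decides = proj₂ (proj₂ (correct G))

        T : ℕ
        T = suc (t₁ + t₂)

        T^d≤ : T ^ d ≤ C₀ * 2 ^ n
        T^d≤ = begin
          (1 + (t₁ + t₂)) ^ d                          ≤⟨ ^-+-≤ d 1 (t₁ + t₂) ⟩
          2 ^ d * (1 ^ d + (t₁ + t₂) ^ d)
            ≤⟨ *-monoʳ-≤ (2 ^ d) (+-mono-≤ (≤-trans (≤-reflexive (^-zeroˡ d)) (m^n>0 2 n))
                                                            (≤-trans (^-+-≤ d t₁ t₂) (*-monoʳ-≤ (2 ^ d) (+-mono-≤ t₁≤ t₂≤)))) ⟩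
          2 ^ d * (2 ^ n + 2 ^ d * (C₁ * 2 ^ n + C₂ * 2 ^ n))
            ≡⟨ solve 4 (λ x z a b → x :* (z :+ x :* (a :* z :+ b :* z)) :=
                                                            x :* (con 1 :+ x :* (a :+ b)) :* z) refl (2 ^ d) (2 ^ n) C₁ C₂ ⟩
          C₀ * 2 ^ n                                   ∎
          where
          open ≤-Reasoning
          open +-*-Solver using (solve; _:+_; _:*_; _:=_; con)
          t₁≤ : t₁ ^ d ≤ C₁ * 2 ^ n
          t₁≤ = reduction-bound r≤2ℓB B-large M {m} {n} {s} m≤cn sB≤ {K = K} {Q = Q} {W = W} W≤
          t₂≤ : t₂ ^ d ≤ C₂ * 2 ^ n
          t₂≤ = oracle-bound r≤2ℓB B-large M {m} {n} {s} m≤cn sB≤ {C = C} {N = 1 ⊔ order G} {q = q} {t = t₂} order≤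
            (subst (λ k → t₂ ^ D ≤ C ^ D * (1 ⊔ order G) ^ k) (+-identityʳ r) (proj₁ (proj₂ decides)))

        T≤ : T ≤[ C₀ * 2 ^[ δ₀ * n ]]
        -- δ₀ is at least 1/d, d being its denominator, so time 2^(n/d) up to a constant is fast
        -- enough.
        T≤ = ≤-trans T^d≤ (*-mono-≤ (m≤m^k C₀ d)
          (^-monoʳ-≤ 2 (m≤n*m n ℤ.∣ ↥ δ₀ ∣ {{>-nonZero (numerator-positive 0<δ₀)}})))

        evaluate : ∀ ω → ∃[ t ] Eval (reductionP rule ⨾ p) (encodeFormula φ) ω y ω t × t ≤ T
        evaluate ω = let t , ev , t≤ = run reduce ω in
          suc (t + t₂) , ev ⨾ Eval-++ (proj₁ decides) ω , s≤s (+-monoˡ-≤ t₂ t≤)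

        outputs : ∀ {z} → y ≡ z → Probability≥2/3 T (Outputs (reductionP rule ⨾ p) (encodeFormula φ) z)
        outputs refl = certain T λ ω → let t , ev , _ = evaluate (toList ω) in _ , t , ev

        opt-small : SatisfiesFewerThan[1- ε ] φ → opt G < r
        opt-small fewer = ≰⇒> λ r≤opt →
          let a , h , m≤ , h≤ = clique⇒mostly-satisfied φ ℓ 2≤r Bℓ≤r (≤-trans r≤opt (≤-reflexive (opt-graph us)))
          -- The clique misses at most a fraction 2^(-ℓ) of the clauses, which is below 1/ℓ since ℓ
          -- ≤ 2^ℓ.
          in few-missed ε 0<ε {satisfied a φ} {h} {length φ} m≤ (≤-trans (*-monoʳ-≤ h (≤-trans (n≤1+n ℓ) (suc≤2^ ℓ))) h≤) (fewer a)

      algorithm : Σ[ T ∈ ℕ ] T ≤[ C₀ * 2 ^[ δ₀ * n ]]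
        × HaltsWithin T (reductionP rule ⨾ p) (encodeFormula φ)
        × (Satisfiable φ → Probability≥2/3 T (Outputs (reductionP rule ⨾ p) (encodeFormula φ) output1))
        × (SatisfiesFewerThan[1- ε ] φ → Probability≥2/3 T (Outputs (reductionP rule ⨾ p) (encodeFormula φ) output0))
      algorithm = T , T≤ ,
        (λ ω → let t , ev , t≤ = evaluate (toList ω) in y , toList ω , t , ev , t≤) ,
        (λ sat → outputs (proj₁ (proj₂ (proj₂ decides))
          (≤-trans (satisfiable⇒clique first rest warmUp φ sat) (≤-reflexive (sym (opt-graph us)))))) ,
        (λ fewer → outputs (proj₂ (proj₂ (proj₂ decides)) (opt-small fewer)))

    3SATAlgorithm : Gap3SATAlgorithm δ₀ ε c
    3SATAlgorithm = reductionP rule ⨾ p , C₀ , λ n φ m≤cn → algorithm φ m≤cn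

  gap⇒3SAT : ∀ q r → q ≥ r → r ≥ r₀ → GapAlgorithm encodeGraph order opt (1/ D) q r → Gap3SATAlgorithm δ₀ ε c
  gap⇒3SAT q r q≥r r≥r₀ gap =
    let b , Bℓ≤r , r≤2ℓB , B-large = choose-density r≥r₀
    in Construction.3SATAlgorithm q r q≥r r≥r₀ b Bℓ≤r r≤2ℓB B-large gap

-- Sizes of graphs and the measure of the running time

size-list : ∀ {k} ts → All (λ t → size t ≤ k) ts → size (list ts) ≤ 1 + length ts * suc k
size-list []       []          = ≤-refl
size-list (t ∷ ts) (t≤ ∷ ts≤) = s≤s (≤-trans (+-mono-≤ t≤ (size-list ts ts≤)) (≤-reflexive (+-suc _ _)))

size-bit : ∀ b → size (bit b) ≤ 3
size-bit true  = ≤-refl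
size-bit false = s≤s z≤n

-- A bit has at most three nodes and its list cell adds one, whence the 4. Replacing the order by
-- its maximum with 1 merges all terms into a single power, and 7 = 1 + 2 + 4.
size-encodeGraph : ∀ G → 1 ⊔ size (encodeGraph G) ≤ 7 * (1 ⊔ order G) ^ 2
size-encodeGraph G = ⊔-lub (≤-trans (m^n>0 X {{X≢0}} 2) (m≤n*m (X ^ 2) 7)) (begin
  size (encodeGraph G)          ≤⟨ size-list _ (All.tabulate⁺ row) ⟩
  1 + length (List.tabulate {n = N} _) * suc (1 + N * 4)
    ≡⟨ cong (λ k → 1 + k * suc (1 + N * 4)) (List.length-tabulate {n = N} _) ⟩
  1 + N * (2 + N * 4)
    ≤⟨ +-mono-≤ (m^n>0 X {{X≢0}} 2) (*-mono-≤ N≤X (+-mono-≤ (m≤m*n 2 X {{X≢0}}) (*-monoˡ-≤ 4 N≤X))) ⟩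
  X ^ 2 + X * (2 * X + X * 4)
    ≡⟨ solve 1 (λ X → X :* (X :* con 1) :+ X :* (con 2 :* X :+ X :* con 4) := con 7 :* (X :* (X :* con 1))) refl X ⟩
  7 * X ^ 2                     ∎)
  where
  open ≤-Reasoning
  open +-*-Solver using (solve; _:+_; _:*_; _:=_; con)
  N = order G
  X = 1 ⊔ N
  X≢0 : NonZero X
  X≢0 = >-nonZero (m≤m⊔n 1 N)
  N≤X : N ≤ X
  N≤X = m≤n⊔m 1 N
  row : ∀ u → size (list (List.tabulate λ v → bit (adjacent G u v))) ≤ 1 + N * 4
  row u = ≤-trans (size-list _ (All.tabulate⁺ λ v → size-bit (adjacent G u v)))
    (≤-reflexive (cong (λ k → 1 + k * 4) (List.length-tabulate {n = N} _)))

-- The encoding is quadratic in the order, so halving δ turns a time bound in the size into one in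
-- the order. The factor 7^r goes into the constant because r is fixed.
size⇒order : ∀ opt D′ q r → GapAlgorithm encodeGraph (size ∘ encodeGraph) opt (1/ (2 * suc D′)) q r →
             GapAlgorithm encodeGraph order opt (1/ (suc D′)) q r
size⇒order opt D′ q r (p , C , correct) = p , C * 7 ^ r , λ G →
  let y , t , ev , t≤ , decides = correct G in y , t , ev , bound G t t≤ , decides
  where
  D = suc D′
  bound : ∀ G t → t ^ (2 * D) ≤ C ^ (2 * D) * (1 ⊔ size (encodeGraph G)) ^ (1 * r) →
          t ^ D ≤ (C * 7 ^ r) ^ D * (1 ⊔ order G) ^ (1 * r)
  bound G t t≤ = ^-cancelʳ-≤ 2 (begin
    (t ^ D) ^ 2
      ≡⟨ trans (^-*-assoc t D 2) (cong (t ^_) (*-comm D 2)) ⟩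
    t ^ (2 * D)                                          ≤⟨ t≤ ⟩
    C ^ (2 * D) * (1 ⊔ size (encodeGraph G)) ^ (1 * r)
      ≡⟨ cong₂ (λ k l → C ^ k * (1 ⊔ size (encodeGraph G)) ^ l) (*-comm 2 D) (*-identityˡ r) ⟩
    C ^ (D * 2) * (1 ⊔ size (encodeGraph G)) ^ r
      ≤⟨ *-monoʳ-≤ (C ^ (D * 2)) (^-monoˡ-≤ r (size-encodeGraph G)) ⟩
    C ^ (D * 2) * (7 * X ^ 2) ^ r
      ≡⟨ cong₂ _*_ (sym (^-*-assoc C D 2)) (^-distribʳ-* r 7 (X ^ 2)) ⟩
    (C ^ D) ^ 2 * (7 ^ r * (X ^ 2) ^ r)
      ≤⟨ *-monoʳ-≤ ((C ^ D) ^ 2) (*-mono-≤ (≤-trans (m≤m^k (7 ^ r) D) (m≤m^k _ 2))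
                                                              (≤-reflexive (trans (^-*-assoc X 2 r) (trans (cong (X ^_) (*-comm 2 r)) (sym (^-*-assoc X r 2)))))) ⟩
    (C ^ D) ^ 2 * (((7 ^ r) ^ D) ^ 2 * (X ^ r) ^ 2)
      ≡⟨ cong ((C ^ D) ^ 2 *_) (^-distribʳ-* 2 ((7 ^ r) ^ D) (X ^ r)) ⟨
    (C ^ D) ^ 2 * ((7 ^ r) ^ D * X ^ r) ^ 2              ≡⟨ ^-distribʳ-* 2 (C ^ D) _ ⟨
    (C ^ D * ((7 ^ r) ^ D * X ^ r)) ^ 2
      ≡⟨ cong (_^ 2) (trans (sym (*-assoc (C ^ D) ((7 ^ r) ^ D) (X ^ r)))
                                                              (cong₂ (λ a k → a * X ^ k) (sym (^-distribʳ-* D C (7 ^ r))) (sym (*-identityˡ r)))) ⟩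
    ((C * 7 ^ r) ^ D * X ^ (1 * r)) ^ 2                  ∎)
    where
    open ≤-Reasoning
    X = 1 ⊔ order G

-- Fixed-parameter approximation

fraction-mono : ∀ {m n} → m ≤ n → (+ m) ℚ./ 1 ℚ.≤ (+ n) ℚ./ 1
fraction-mono {m} {n} m≤n = ℚ.toℚᵘ-cancel-≤ (begin
  toℚᵘ ((+ m) ℚ./ 1)    ≃⟨ ℚ.toℚᵘ-fromℚᵘ (ℚᵘ.mkℚᵘ (+ m) 0) ⟩
  ℚᵘ.mkℚᵘ (+ m) 0       ≤⟨ ℚᵘ.*≤* (ℤ.*-monoʳ-≤-nonNeg (+ 1) (ℤ.+≤+ m≤n)) ⟩
  ℚᵘ.mkℚᵘ (+ n) 0       ≃⟨ ℚᵘ.≃-sym (ℚ.toℚᵘ-fromℚᵘ (ℚᵘ.mkℚᵘ (+ n) 0)) ⟩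
  toℚᵘ ((+ n) ℚ./ 1)    ∎)
  where
  open ℚᵘ.≤-Reasoning

-- A single approximation may lie below 1, but `≥1` makes each upper bound `approx k j ℚ.+ 1/suc j`
-- at least 1. Multiplication by it is therefore monotone.
</[]-downward : ∀ f k {m n} → m ≤ n → n < k /[ f ] → m < k /[ f ]
</[]-downward f k {m} {n} m≤n (j , n<) = j , ℚ.≤-<-trans
  (ℚ.*-monoʳ-≤-nonNeg (approx k j ℚ.+ 1/suc j) {{ℚ.nonNegative 0≤}} (fraction-mono m≤n)) n<
  where
  open ComputableFunction[1,∞⟩ f
  open ℚ.≤-Reasoning
  0≤ : 0ℚ ℚ.≤ approx k j ℚ.+ 1/suc j
  0≤ = begin
    0ℚ                                ≤⟨ ℚ.nonNegative⁻¹ 1ℚ ⟩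
    1ℚ                                ≡⟨ ℚ.+-identityʳ 1ℚ ⟨
    1ℚ ℚ.+ 0ℚ                         ≡⟨ cong (1ℚ ℚ.+_) (ℚ.+-inverseˡ (1/suc j)) ⟨
    1ℚ ℚ.+ (ℚ.- 1/suc j ℚ.+ 1/suc j)  ≡⟨ ℚ.+-assoc 1ℚ (ℚ.- 1/suc j) (1/suc j) ⟨
    1ℚ ℚ.- 1/suc j ℚ.+ 1/suc j        ≤⟨ ℚ.+-monoˡ-≤ (1/suc j) (≥1 k j) ⟩
    approx k j ℚ.+ 1/suc j            ∎

-- For a fixed large k the FPT algorithm separates OPT ≥ k from OPT < r, because r < k/f(k). Its
-- factor t(k) is then a constant, and its exponent c is at most δ r once r is large.
enumerative⇒inapproximable : ∀ Π → InherentlyEnumerative Π → TotallyFPTInapproximable Π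
enumerative⇒inapproximable Π (δ , r₀ , 0<δ , _ , hard) f k/f→∞ (p , t , c , _ , correct) =
  hard k r (m≤n+m r k₀) (m≤m+n r₀ (c * ↧ₙ δ)) (withParameter ⨾ p , C , λ I →
    let y , s , ev , s≤ , large , small = correct I k
        u , ev₀ , u≤ = run supply []
    in y , suc (u + s) , ev₀ ⨾ ev , time I u s (≤-trans u≤ (≤-reflexive (*-identityʳ K))) s≤ , large ,
       λ opt<r → small (</[]-downward f k (<⇒≤ opt<r) (proj₂ (k/f→∞ r) k (m≤m+n k₀ r))))
  where
  open MaximizationProblem Π

  r k₀ k K C : ℕ
  -- The numerator of δ is at least 1, so the summand `c * ↧ₙ δ` ensures δ r ≥ c. Adding r to k₀
  -- makes k at least r as well.
  r  = r₀ + c * ↧ₙ δ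
  k₀ = proj₁ (k/f→∞ r)
  k  = k₀ + r
  K  = suc (1 + steps (constant (unary k)))
  C  = suc K + t k

  withParameter : Program
  withParameter = cons id (constant (unary k))

  supply : ∀ {x} → Runs 0 0 K withParameter x (cons x (unary k))
  supply = consʳ pure (constantʳ (unary k))

  time : ∀ I u s → u ≤ K → s ≤ t k * ∥ I ∥ ^ c → suc (u + s) ≤[ C * (1 ⊔ ∥ I ∥) ^[ δ * r ]]
  time I u s u≤ s≤ = begin
    suc (u + s) ^ ↧ₙ δ               ≤⟨ ^-monoˡ-≤ (↧ₙ δ) (begin
      suc u + s
        ≤⟨ +-mono-≤ (≤-trans (s≤s u≤) (m≤m*n (suc K) (X ^ c) {{m^n≢0 X c {{X≢0}}}}))
                                            (≤-trans s≤ (*-monoʳ-≤ (t k) (^-monoˡ-≤ c (m≤n⊔m 1 ∥ I ∥)))) ⟩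
      suc K * X ^ c + t k * X ^ c      ≡⟨ *-distribʳ-+ (X ^ c) (suc K) (t k) ⟨
      C * X ^ c                        ∎) ⟩
    (C * X ^ c) ^ ↧ₙ δ
      ≡⟨ trans (^-distribʳ-* (↧ₙ δ) C (X ^ c)) (cong (C ^ ↧ₙ δ *_) (^-*-assoc X c (↧ₙ δ))) ⟩
    C ^ ↧ₙ δ * X ^ (c * ↧ₙ δ)
      ≤⟨ *-monoʳ-≤ (C ^ ↧ₙ δ) (^-monoʳ-≤ X {{X≢0}} (≤-trans (m≤n+m (c * ↧ₙ δ) r₀)
                                          (m≤n*m r ℤ.∣ ↥ δ ∣ {{>-nonZero (numerator-positive 0<δ)}}))) ⟩
    C ^ ↧ₙ δ * X ^ (ℤ.∣ ↥ δ ∣ * r)   ∎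
    where
    open ≤-Reasoning
    X = 1 ⊔ ∥ I ∥
    X≢0 : NonZero X
    X≢0 = >-nonZero (m≤m⊔n 1 ∥ I ∥)

theorem5p1 : GapETH →
    (Σ[ δ ∈ ℚ ] Σ[ r₀ ∈ ℕ ]
    0ℚ ℚ.< δ × 0 < r₀ ×
    (∀ q r → q ≥ r → r ≥ r₀ → ¬ CliqueGapAlgorithm δ q r))
    × (InherentlyEnumerative MaximumClique × InherentlyEnumerative MaximumIndependentSet)
    × (TotallyFPTInapproximable MaximumClique × TotallyFPTInapproximable MaximumIndependentSet)
theorem5p1 (δ₀ , ε , c , 0<δ₀ , 0<ε , ¬algorithm) =
  (1/ D , r₀ , 1/-positive D , s≤s z≤n , hard cliqueTarget) ,
  (clique , independent) ,
  enumerative⇒inapproximable MaximumClique clique ,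
  enumerative⇒inapproximable MaximumIndependentSet independent
  where
  open Parameters (ℚ.denominator-1 δ₀) (ℚ.denominator-1 ε) c using (D; r₀)

  hard : ∀ target q r → q ≥ r → r ≥ r₀ → ¬ GapAlgorithm encodeGraph order (Target.opt target) (1/ D) q r
  hard target q r q≥r r≥r₀ = ¬algorithm ∘ gap⇒3SAT target δ₀ ε c 0<δ₀ 0<ε q r q≥r r≥r₀

  clique : InherentlyEnumerative MaximumClique
  clique = 1/ (2 * D) , r₀ , 1/-positive (2 * D) , s≤s z≤n , λ q r q≥r r≥r₀ →
    hard cliqueTarget q r q≥r r≥r₀ ∘ size⇒order cliqueNumber (pred D) q r

  independent : InherentlyEnumerative MaximumIndependentSet
  independent = 1/ (2 * D) , r₀ , 1/-positive (2 * D) , s≤s z≤n , λ q r q≥r r≥r₀ →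
    hard independenceTarget q r q≥r r≥r₀ ∘ size⇒order independenceNumber (pred D) q r
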